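{- Let $t\geq s \geq 2$ be integers. Then $$c(K_{s,t}) \leq 40 \left(\sqrt{st \log s}+s+t\right).$$
   Context: All graphs are finite and simple. $K_{s,t}$ is the complete bipartite graph with parts of sizes $s$ and $t$. A graph $H$ is a minor of $G$ if a graph isomorphic to $H$ can be obtained from a subgraph of $G$ by contracting edges. For a non-null graph $G$, $d(G)=e(G)/v(G)$. For a graph $H$ with $v(H)\ge 2$, $c(H)$ is the supremum of $d(G)$ over all non-null graphs $G$ not containing $H$ as a minor. $\log$ is the natural logarithm. -}

module Defs where

open import Data.Nat as ℕ using (ℕ; zero; suc; _<ᵇ_)
open import Data.Bool using (Bool; true; false; if_then_else_; _∧_)
open import Data.Fin using (Fin; toℕ)
open import Data.List using (List; map; allFin)
open import Data.Nat.ListAction using (sum)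
open import Data.Maybe using (Maybe; just)
open import Data.Sum using (_⊎_; inj₁; inj₂)
open import Data.Product using (∃; ∃₂; _×_)
open import Data.Integer using (+_)
open import Data.Rational using (ℚ; _/_; _*_; _+_; _≤_; 0ℚ; 1ℚ)
open import Relation.Binary.PropositionalEquality using (_≡_)

record Graph (n : ℕ) : Set where
  field
    adj     : Fin n → Fin n → Bool
    symm    : ∀ u v → adj u v ≡ adj v u
    irrefl  : ∀ v → adj v v ≡ false
open Graph public

edgeCount : ∀ {n} → Graph n → ℕ
edgeCount {n} G =
  sum (map (λ i → sum (map (λ j → if (toℕ i <ᵇ toℕ j) ∧ adj G i j then 1 else 0)
                           (allFin n)))
           (allFin n))

data PathIn {n : ℕ} (G : Graph n) (P : Fin n → Set) : Fin n → Fin n → Set where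
  here : ∀ {u} → P u → PathIn G P u u
  step : ∀ {u w v} → P u → adj G u w ≡ true → PathIn G P w v → PathIn G P u v

record KstMinorModel (s t : ℕ) {n : ℕ} (G : Graph n) : Set where
  field
    branch    : Fin n → Maybe (Fin s ⊎ Fin t)
    nonempty  : ∀ b → ∃ λ v → branch v ≡ just b
    connected : ∀ b u v → branch u ≡ just b → branch v ≡ just b →
                PathIn G (λ w → branch w ≡ just b) u v
    adjacent  : ∀ a c → ∃₂ λ u v → branch u ≡ just (inj₁ a) ×
                                   branch v ≡ just (inj₂ c) × adj G u v ≡ true

HasKstMinor : ℕ → ℕ → ∀ {n} → Graph n → Set
HasKstMinor s t G = KstMinorModel s t G

density : ∀ {n} → Graph (suc n) → ℚ
density {n} G = (+ edgeCount G) / suc n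

expTerm : ℚ → ℕ → ℚ
expTerm y zero    = 1ℚ
expTerm y (suc k) = expTerm y k * y * ((+ 1) / suc k)

expPartial : ℚ → ℕ → ℚ
expPartial y zero    = 1ℚ
expPartial y (suc N) = expPartial y N + expTerm y (suc N)

-- For q ≥ 0:  q ≤ m · log s.  (m = 0: q ≤ 0; m > 0: exp(q/m) ≤ s, i.e.
-- every partial sum of the exponential series of q/m is ≤ s.)
LeMulLog : ℚ → ℕ → ℕ → Set
LeMulLog q zero    s = q ≤ 0ℚ
LeMulLog q (suc m) s = ∀ N → expPartial (q * ((+ 1) / suc m)) N ≤ ((+ s) / 1)

-- x ≤ √(m · log s)   (for s ≥ 1): either x ≤ 0, or x² ≤ m · log s.
LeSqrtMulLog : ℚ → ℕ → ℕ → Set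
LeSqrtMulLog x m s = x ≤ 0ℚ ⊎ LeMulLog (x * x) m s

{-# OPTIONS --safe #-}
module Submission where

-- Let K = ⌊d(G)⌋. Deleting edges and contracting edges that lie in fewer than K triangles, while
-- e ≥ K v is maintained, ends in a graph with a vertex v of degree h ≤ 2K such that every vertex of
-- N(v) has at least K neighbours in N(v). The sum of the degrees inside N(v) is at least
-- K h ≥ (3 h² + 2 K h) / 8. Take S ⊆ N(v) minimal with degree sum at least (3 |S|² + 2 K |S|) / 8.
-- Then |S| ≥ 2K/5, and by minimality every partition of S into U and W is crossed by at least
-- 3 |U| |W| / 8 edges, and all degrees in S are at least about (3 |S| + K) / 8.
--
-- Because of the cut bound, a connected set inside S can be extended by a vertex adjacent to a fifth
-- of the vertices of S not dominated so far, even when a small part of S is forbidden. Hence there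
-- are s disjoint connected sets of p + 3 vertices, each missing a proportion of only (4/5)ᵖ of any
-- neighbourhood. A path of q + 1 vertices, each chosen greedily in the unused neighbourhood of the
-- previous one, touches all s sets as soon as s (4/5)^(p (q + 1)) < 1, and there is room for t such
-- paths. With x = d(G) / 40 - (s + t) one takes p ≈ 2x / s and q + 1 ≈ 5x / (2t), so that
-- p (q + 1) ≥ 5 x² / (st) > 5 log s, and (4/5) e^(1/5) ≤ 1.

open import Defs
open import Data.Nat as ℕ using (ℕ; zero; suc)
open import Data.Nat.Properties
import Data.Nat.Properties as ℕ
open import Data.Nat.DivMod using (m/n*n≤m; m≡m%n+[m/n]*n; m%n<n; m*n/n≡m; /-monoˡ-≤)
import Data.Nat.ListAction as List
open import Data.Nat.Tactic.RingSolver using (solve-∀)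
open import Data.Integer using (+_)
import Data.Integer as ℤ
import Data.Integer.Properties as ℤ
import Data.Rational
open import Data.Rational as ℚ using (ℚ; _/_; _-_; 0ℚ; 1ℚ)
import Data.Rational.Properties as ℚ
open import Data.Rational.Solver using (module +-*-Solver)
open import Data.Rational.Unnormalised as ℚᵘ using (mkℚᵘ; *≡*; *≤*; *<*)
import Data.Rational.Unnormalised.Properties as ℚᵘ
open import Data.Bool as Bool using (Bool; true; false; if_then_else_; _∧_; _∨_; not; T)
import Data.Bool.Properties as Bool
open import Data.Unit using (tt)
open import Data.Empty using (⊥; ⊥-elim)
open import Data.Maybe using (Maybe; just; nothing)
open import Data.Sum using (_⊎_; inj₁; inj₂)
open import Data.Product using (∃; ∃₂; _×_; _,_; proj₁; proj₂)
open import Data.Fin as Fin using (Fin; toℕ; zero; suc)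
open import Data.Fin.Properties using (any?)
open import Data.List using (map; allFin; tabulate)
open import Data.List.Properties using (map-tabulate)
open import Function using (_∘_; id)
open import Relation.Nullary using (¬_; Dec; yes; no; does)
open import Relation.Nullary.Decidable using (_×-dec_; decidable-stable)
open import Relation.Binary.PropositionalEquality
open import Algebra.Properties.Semiring.Sum +-*-semiring
  using (sum; sum-cong-≗; ∑-distrib-+; ∑-comm; *-distribˡ-sum; *-distribʳ-sum)

-- Rationals and the exponential series

ι : ℕ → ℚ
ι m = (+ m) / 1

-- `(+ a) / suc b` unfolds to `fromℚᵘ (mkℚᵘ (+ a) b)`, so identities between fractions can be
-- checked on unnormalised rationals, where no gcd gets in the way.
fromℚᵘ-+ : ∀ p q → ℚ.fromℚᵘ (p ℚᵘ.+ q) ≡ ℚ.fromℚᵘ p ℚ.+ ℚ.fromℚᵘ q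
fromℚᵘ-+ p q = ℚ.toℚᵘ-injective (begin
  ℚ.toℚᵘ (ℚ.fromℚᵘ (p ℚᵘ.+ q))                          ≈⟨ ℚ.toℚᵘ-fromℚᵘ (p ℚᵘ.+ q) ⟩
  p ℚᵘ.+ q                                              ≈⟨ ℚᵘ.+-cong (ℚ.toℚᵘ-fromℚᵘ p) (ℚ.toℚᵘ-fromℚᵘ q) ⟨
  ℚ.toℚᵘ (ℚ.fromℚᵘ p) ℚᵘ.+ ℚ.toℚᵘ (ℚ.fromℚᵘ q)          ≈⟨ ℚ.toℚᵘ-homo-+ (ℚ.fromℚᵘ p) (ℚ.fromℚᵘ q) ⟨
  ℚ.toℚᵘ (ℚ.fromℚᵘ p ℚ.+ ℚ.fromℚᵘ q)                    ∎)
  where open ℚᵘ.≃-Reasoning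

fromℚᵘ-* : ∀ p q → ℚ.fromℚᵘ (p ℚᵘ.* q) ≡ ℚ.fromℚᵘ p ℚ.* ℚ.fromℚᵘ q
fromℚᵘ-* p q = ℚ.toℚᵘ-injective (begin
  ℚ.toℚᵘ (ℚ.fromℚᵘ (p ℚᵘ.* q))                          ≈⟨ ℚ.toℚᵘ-fromℚᵘ (p ℚᵘ.* q) ⟩
  p ℚᵘ.* q                                              ≈⟨ ℚᵘ.*-cong (ℚ.toℚᵘ-fromℚᵘ p) (ℚ.toℚᵘ-fromℚᵘ q) ⟨
  ℚ.toℚᵘ (ℚ.fromℚᵘ p) ℚᵘ.* ℚ.toℚᵘ (ℚ.fromℚᵘ q)          ≈⟨ ℚ.toℚᵘ-homo-* (ℚ.fromℚᵘ p) (ℚ.fromℚᵘ q) ⟨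
  ℚ.toℚᵘ (ℚ.fromℚᵘ p ℚ.* ℚ.fromℚᵘ q)                    ∎)
  where open ℚᵘ.≃-Reasoning

fromℚᵘ-mono-≤ : ∀ {p q} → p ℚᵘ.≤ q → ℚ.fromℚᵘ p ℚ.≤ ℚ.fromℚᵘ q
fromℚᵘ-mono-≤ {p} {q} p≤q = ℚ.toℚᵘ-cancel-≤
  (ℚᵘ.≤-respʳ-≃ (ℚᵘ.≃-sym (ℚ.toℚᵘ-fromℚᵘ q)) (ℚᵘ.≤-respˡ-≃ (ℚᵘ.≃-sym (ℚ.toℚᵘ-fromℚᵘ p)) p≤q))

fromℚᵘ-cancel-≤ : ∀ {p q} → ℚ.fromℚᵘ p ℚ.≤ ℚ.fromℚᵘ q → p ℚᵘ.≤ q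
fromℚᵘ-cancel-≤ {p} {q} p≤q =
  ℚᵘ.≤-respʳ-≃ (ℚ.toℚᵘ-fromℚᵘ q) (ℚᵘ.≤-respˡ-≃ (ℚ.toℚᵘ-fromℚᵘ p) (ℚ.toℚᵘ-mono-≤ p≤q))

fromℚᵘ-cancel-< : ∀ {p q} → ℚ.fromℚᵘ p ℚ.< ℚ.fromℚᵘ q → p ℚᵘ.< q
fromℚᵘ-cancel-< {p} {q} p<q =
  ℚᵘ.<-respʳ-≃ (ℚ.toℚᵘ-fromℚᵘ q) (ℚᵘ.<-respˡ-≃ (ℚ.toℚᵘ-fromℚᵘ p) (ℚ.toℚᵘ-mono-< p<q))

ι-+ : ∀ a b → ι (a ℕ.+ b) ≡ ι a ℚ.+ ι b
ι-+ a b = trans (ℚ.fromℚᵘ-cong {mkℚᵘ (+ (a ℕ.+ b)) 0} {mkℚᵘ (+ a) 0 ℚᵘ.+ mkℚᵘ (+ b) 0} (*≡* (cong (ℤ._* + 1) (sym (cong₂ ℤ._+_ (ℤ.*-identityʳ (+ a)) (ℤ.*-identityʳ (+ b)))))))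
                (fromℚᵘ-+ (mkℚᵘ (+ a) 0) (mkℚᵘ (+ b) 0))

ι-* : ∀ a b → ι (a ℕ.* b) ≡ ι a ℚ.* ι b
ι-* a b = trans (ℚ.fromℚᵘ-cong {mkℚᵘ (+ (a ℕ.* b)) 0} {mkℚᵘ (+ a) 0 ℚᵘ.* mkℚᵘ (+ b) 0} (*≡* (cong (ℤ._* + 1) (ℤ.pos-* a b))))
                (fromℚᵘ-* (mkℚᵘ (+ a) 0) (mkℚᵘ (+ b) 0))

ι-inverse : ∀ m → ι (suc m) ℚ.* ((+ 1) / suc m) ≡ 1ℚ
ι-inverse m = trans (sym (fromℚᵘ-* (mkℚᵘ (+ suc m) 0) (mkℚᵘ (+ 1) m)))
  (ℚ.fromℚᵘ-cong {mkℚᵘ (+ suc m) 0 ℚᵘ.* mkℚᵘ (+ 1) m} {mkℚᵘ (+ 1) 0} (ℚᵘ.*-inverseʳ (mkℚᵘ (+ suc m) 0)))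

/-mono-≤ : ∀ {a b c d} → a ℕ.* suc d ℕ.≤ c ℕ.* suc b → (+ a) / suc b ℚ.≤ (+ c) / suc d
/-mono-≤ {a} {b} {c} {d} le = fromℚᵘ-mono-≤ {mkℚᵘ (+ a) b} {mkℚᵘ (+ c) d}
  (*≤* (subst₂ ℤ._≤_ (ℤ.pos-* a (suc d)) (ℤ.pos-* c (suc b)) (ℤ.+≤+ le)))

/-cancel-≤ : ∀ {a b c d} → (+ a) / suc b ℚ.≤ (+ c) / suc d → a ℕ.* suc d ℕ.≤ c ℕ.* suc b
/-cancel-≤ {a} {b} {c} {d} le with fromℚᵘ-cancel-≤ {mkℚᵘ (+ a) b} {mkℚᵘ (+ c) d} le
... | *≤* p = ℤ.drop‿+≤+ (subst₂ ℤ._≤_ (sym (ℤ.pos-* a (suc d))) (sym (ℤ.pos-* c (suc b))) p)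

/-cancel-< : ∀ {a b c d} → (+ a) / suc b ℚ.< (+ c) / suc d → a ℕ.* suc d ℕ.< c ℕ.* suc b
/-cancel-< {a} {b} {c} {d} lt with fromℚᵘ-cancel-< {mkℚᵘ (+ a) b} {mkℚᵘ (+ c) d} lt
... | *<* p = ℤ.drop‿+<+ (subst₂ ℤ._<_ (sym (ℤ.pos-* a (suc d))) (sym (ℤ.pos-* c (suc b))) p)

ι-mono-≤ : ∀ {a b} → a ℕ.≤ b → ι a ℚ.≤ ι b
ι-mono-≤ {a} {b} le = /-mono-≤ {a} {0} {b} {0} (ℕ.*-monoˡ-≤ 1 le)

ι-cancel-< : ∀ {a b} → ι a ℚ.< ι b → a ℕ.< b
ι-cancel-< {a} {b} lt = ℕ.*-cancelʳ-< 1 a b (/-cancel-< {a} {0} {b} {0} lt)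

ι-mono-< : ∀ {a b} → a ℕ.< b → ι a ℚ.< ι b
ι-mono-< {a} {b} lt = ℚ.≰⇒> λ le → ℕ.<⇒≱ lt (ι-cancel-≤ le)
  where
  ι-cancel-≤ : ι b ℚ.≤ ι a → b ℕ.≤ a
  ι-cancel-≤ le = ℕ.*-cancelʳ-≤ b a 1 (/-cancel-≤ {b} {0} {a} {0} le)

0≤/ : ∀ a b → 0ℚ ℚ.≤ (+ a) / suc b
0≤/ a b = /-mono-≤ {0} {0} {a} {b} ℕ.z≤n

*-monoˡ : ∀ {r p q} → 0ℚ ℚ.≤ r → p ℚ.≤ q → r ℚ.* p ℚ.≤ r ℚ.* q
*-monoˡ {r} 0≤r = ℚ.*-monoˡ-≤-nonNeg r ⦃ ℚ.nonNegative 0≤r ⦄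

*-monoʳ : ∀ {r p q} → 0ℚ ℚ.≤ r → p ℚ.≤ q → p ℚ.* r ℚ.≤ q ℚ.* r
*-monoʳ {r} 0≤r = ℚ.*-monoʳ-≤-nonNeg r ⦃ ℚ.nonNegative 0≤r ⦄

*-nonneg : ∀ {p q} → 0ℚ ℚ.≤ p → 0ℚ ℚ.≤ q → 0ℚ ℚ.≤ p ℚ.* q
*-nonneg {p} {q} 0≤p 0≤q = subst (ℚ._≤ p ℚ.* q) (ℚ.*-zeroʳ p) (*-monoˡ 0≤p 0≤q)

*-mono : ∀ {p q r s} → 0ℚ ℚ.≤ p → 0ℚ ℚ.≤ s → p ℚ.≤ q → r ℚ.≤ s → p ℚ.* r ℚ.≤ q ℚ.* s
*-mono 0≤p 0≤s p≤q r≤s = ℚ.≤-trans (*-monoˡ 0≤p r≤s) (*-monoʳ 0≤s p≤q)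

-- Growth of the partial sums of the exponential series

module Exponential where
  open Data.Rational using (_+_; _*_; _≤_)
  open ℚ.≤-Reasoning

  0≤1 : 0ℚ ≤ 1ℚ
  0≤1 = 0≤/ 1 0

  term-nonneg : ∀ {y} → 0ℚ ≤ y → ∀ k → 0ℚ ≤ expTerm y k
  term-nonneg 0≤y zero    = 0≤1
  term-nonneg 0≤y (suc k) = *-nonneg (*-nonneg (term-nonneg 0≤y k) 0≤y) (0≤/ 1 k)

  term-mono : ∀ {p q} → 0ℚ ≤ p → p ≤ q → ∀ k → expTerm p k ≤ expTerm q k
  term-mono 0≤p p≤q zero    = ℚ.≤-refl
  term-mono 0≤p p≤q (suc k) = *-monoʳ (0≤/ 1 k)
    (*-mono (term-nonneg 0≤p k) (ℚ.≤-trans 0≤p p≤q) (term-mono 0≤p p≤q k) p≤q)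

  partial-mono : ∀ {p q} → 0ℚ ≤ p → p ≤ q → ∀ N → expPartial p N ≤ expPartial q N
  partial-mono 0≤p p≤q zero    = ℚ.≤-refl
  partial-mono 0≤p p≤q (suc N) = ℚ.+-mono-≤ (partial-mono 0≤p p≤q N) (term-mono 0≤p p≤q (suc N))

  term-zero : ∀ k → expTerm 0ℚ (suc k) ≡ 0ℚ
  term-zero k = trans (cong (_* ((+ 1) / suc k)) (ℚ.*-zeroʳ (expTerm 0ℚ k))) (ℚ.*-zeroˡ ((+ 1) / suc k))

  partial-zero : ∀ N → expPartial 0ℚ N ≡ 1ℚ
  partial-zero zero    = refl
  partial-zero (suc N) = trans (cong₂ _+_ (partial-zero N) (term-zero N)) (ℚ.+-identityʳ 1ℚ)

  module _ {x h} (0≤x : 0ℚ ≤ x) (0≤h : 0ℚ ≤ h) where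

    0≤x+h : 0ℚ ≤ x + h
    0≤x+h = ℚ.+-mono-≤ 0≤x 0≤h

    x≤x+h : x ≤ x + h
    x≤x+h = ℚ.≤-trans (ℚ.≤-reflexive (sym (ℚ.+-identityʳ x))) (ℚ.+-monoʳ-≤ x 0≤h)

    -- The mean value inequality for yᵏ / k!, whose derivative is the previous term.
    term-increment : ∀ k → expTerm (x + h) (suc k) ≤ expTerm x (suc k) + h * expTerm (x + h) k
    term-increment zero = ℚ.≤-reflexive (solve 2 (λ x h →
        con 1ℚ :* (x :+ h) :* con 1ℚ := con 1ℚ :* x :* con 1ℚ :+ h :* con 1ℚ) refl x h)
      where open +-*-Solver
    term-increment (suc k) = begin
      T₁ * (x + h) * c                              ≡⟨ expand T₁ x h c ⟩
      c * (T₁ * h + x * T₁)                         ≤⟨ *-monoˡ (0≤/ 1 (suc k)) (ℚ.+-monoʳ-≤ (T₁ * h) (*-monoˡ 0≤x (term-increment k))) ⟩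
      c * (T₁ * h + x * (t₁ + h * T₀))              ≡⟨ regroup c T₁ h x t₁ T₀ ⟩
      c * (T₁ * h + x * t₁) + c * h * (T₀ * x)      ≤⟨ ℚ.+-monoʳ-≤ (c * (T₁ * h + x * t₁)) (*-monoˡ (*-nonneg (0≤/ 1 (suc k)) 0≤h)
                                                         (*-monoˡ (term-nonneg 0≤x+h k) x≤x+h)) ⟩
      c * (T₁ * h + x * t₁) + c * h * (T₀ * (x + h)) ≡⟨ cong (λ z → c * (T₁ * h + x * t₁) + c * h * z) absorb ⟩
      c * (T₁ * h + x * t₁) + c * h * (ι (suc k) * T₁) ≡⟨ collect c T₁ h x t₁ (ι (suc k)) ⟩
      t₁ * x * c + h * T₁ * ((1ℚ + ι (suc k)) * c)  ≡⟨ cong (λ z → t₁ * x * c + h * T₁ * z) (trans (cong (_* c) (sym (ι-+ 1 (suc k)))) (ι-inverse (suc k))) ⟩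
      t₁ * x * c + h * T₁ * 1ℚ                      ≡⟨ cong (_+_ (t₁ * x * c)) (ℚ.*-identityʳ (h * T₁)) ⟩
      t₁ * x * c + h * T₁                           ∎
      where
      open +-*-Solver
      T₀ T₁ t₁ c c′ : ℚ
      T₀ = expTerm (x + h) k
      T₁ = expTerm (x + h) (suc k)
      t₁ = expTerm x (suc k)
      c = (+ 1) / suc (suc k)
      c′ = (+ 1) / suc k
      absorb : T₀ * (x + h) ≡ ι (suc k) * T₁
      absorb = sym (trans (swap (ι (suc k)) (T₀ * (x + h)) c′)
                   (trans (cong ((T₀ * (x + h)) *_) (ι-inverse k)) (ℚ.*-identityʳ (T₀ * (x + h)))))
        where
        swap : ∀ a b d → a * (b * d) ≡ b * (a * d)
        swap = solve 3 (λ a b d → a :* (b :* d) := b :* (a :* d)) refl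
      expand : ∀ T x h c → T * (x + h) * c ≡ c * (T * h + x * T)
      expand = solve 4 (λ T x h c → T :* (x :+ h) :* c := c :* (T :* h :+ x :* T)) refl
      regroup : ∀ c T h x t T₀ → c * (T * h + x * (t + h * T₀)) ≡ c * (T * h + x * t) + c * h * (T₀ * x)
      regroup = solve 6 (λ c T h x t T₀ → c :* (T :* h :+ x :* (t :+ h :* T₀)) := c :* (T :* h :+ x :* t) :+ c :* h :* (T₀ :* x)) refl
      collect : ∀ c T h x t i → c * (T * h + x * t) + c * h * (i * T) ≡ t * x * c + h * T * ((1ℚ + i) * c)
      collect = solve 6 (λ c T h x t i → c :* (T :* h :+ x :* t) :+ c :* h :* (i :* T) := t :* x :* c :+ h :* T :* ((con 1ℚ :+ i) :* c)) refl

    partial-increment′ : ∀ N → expPartial (x + h) (suc N) ≤ expPartial x (suc N) + h * expPartial (x + h) N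
    partial-increment′ zero = begin
      1ℚ + expTerm (x + h) 1                 ≤⟨ ℚ.+-monoʳ-≤ 1ℚ (term-increment 0) ⟩
      1ℚ + (expTerm x 1 + h * 1ℚ)            ≡⟨ ℚ.+-assoc 1ℚ (expTerm x 1) (h * 1ℚ) ⟨
      1ℚ + expTerm x 1 + h * 1ℚ              ∎
    partial-increment′ (suc N) = begin
      expPartial (x + h) (suc N) + expTerm (x + h) (2 ℕ.+ N)
        ≤⟨ ℚ.+-mono-≤ (partial-increment′ N) (term-increment (suc N)) ⟩
      expPartial x (suc N) + h * expPartial (x + h) N + (expTerm x (2 ℕ.+ N) + h * expTerm (x + h) (suc N))
        ≡⟨ collect (expPartial x (suc N)) h (expPartial (x + h) N) (expTerm x (2 ℕ.+ N)) (expTerm (x + h) (suc N)) ⟩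
      expPartial x (suc N) + expTerm x (2 ℕ.+ N) + h * (expPartial (x + h) N + expTerm (x + h) (suc N)) ∎
      where
      open +-*-Solver
      collect : ∀ a h b c d → a + h * b + (c + h * d) ≡ a + c + h * (b + d)
      collect = solve 5 (λ a h b c d → a :+ h :* b :+ (c :+ h :* d) := a :+ c :+ h :* (b :+ d)) refl

    -- The term-wise bound leaves a shorter partial sum on the right. Adding its nonnegative last
    -- term gives both sides the same length, and the inequality can be solved for
    -- `expPartial (x + h) N`.
    partial-increment : ∀ N → expPartial (x + h) N ≤ expPartial x N + h * expPartial (x + h) N
    partial-increment zero    = ℚ.≤-trans (ℚ.≤-reflexive (sym (ℚ.+-identityʳ 1ℚ))) (ℚ.+-monoʳ-≤ 1ℚ (*-nonneg 0≤h 0≤1))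
    partial-increment (suc N) = ℚ.≤-trans (partial-increment′ N) (ℚ.+-monoʳ-≤ (expPartial x (suc N)) (*-monoˡ 0≤h
      (ℚ.≤-trans (ℚ.≤-reflexive (sym (ℚ.+-identityʳ (expPartial (x + h) N))))
                 (ℚ.+-monoʳ-≤ (expPartial (x + h) N) (term-nonneg 0≤x+h (suc N))))))

  ⅕ : ℚ
  ⅕ = (+ 1) / 5

  -- A discrete form of (4/5) · exp (1/5) ≤ 1.
  partial-step : ∀ {x} → 0ℚ ≤ x → ∀ N → ι 4 * expPartial (x + ⅕) N ≤ ι 5 * expPartial x N
  partial-step {x} 0≤x N = begin
    ι 4 * B                     ≡⟨ shift B ⟩
    ι 5 * B + ℚ.- B             ≤⟨ ℚ.+-monoˡ-≤ (ℚ.- B) (*-monoˡ (0≤/ 5 0) (partial-increment 0≤x (0≤/ 1 4) N)) ⟩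
    ι 5 * (A + ⅕ * B) + ℚ.- B   ≡⟨ cancel A B ⟩
    ι 5 * A                     ∎
    where
    open +-*-Solver
    A B : ℚ
    A = expPartial x N
    B = expPartial (x + ⅕) N
    shift : ∀ B → ι 4 * B ≡ ι 5 * B + ℚ.- B
    shift = solve 1 (λ B → con (ι 4) :* B := con (ι 5) :* B :+ :- B) refl
    cancel : ∀ A B → ι 5 * (A + ⅕ * B) + ℚ.- B ≡ ι 5 * A
    cancel = solve 2 (λ A B → con (ι 5) :* (A :+ con ⅕ :* B) :+ :- B := con (ι 5) :* A) refl

  -- Iterating `partial-step` from 0 gives exp (m/5) ≤ (5/4)^m, stated without division.
  partial-bound : ∀ m N → ι (4 ℕ.^ m) * expPartial (ι m * ⅕) N ≤ ι (5 ℕ.^ m)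
  partial-bound zero N = ℚ.≤-reflexive (trans (cong (ι 1 *_) (partial-zero N)) (ℚ.*-identityʳ 1ℚ))
  partial-bound (suc m) N = begin
    ι (4 ℕ.* 4 ℕ.^ m) * expPartial (ι (suc m) * ⅕) N       ≡⟨ cong₂ _*_ (ι-* 4 (4 ℕ.^ m)) (cong (λ z → expPartial z N) next) ⟩
    ι 4 * ι (4 ℕ.^ m) * expPartial (ι m * ⅕ + ⅕) N         ≡⟨ swap (ι 4) (ι (4 ℕ.^ m)) (expPartial (ι m * ⅕ + ⅕) N) ⟩
    ι (4 ℕ.^ m) * (ι 4 * expPartial (ι m * ⅕ + ⅕) N)       ≤⟨ *-monoˡ (0≤/ (4 ℕ.^ m) 0) (partial-step (*-nonneg (0≤/ m 0) (0≤/ 1 4)) N) ⟩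
    ι (4 ℕ.^ m) * (ι 5 * expPartial (ι m * ⅕) N)           ≡⟨ swap′ (ι (4 ℕ.^ m)) (ι 5) (expPartial (ι m * ⅕) N) ⟩
    ι 5 * (ι (4 ℕ.^ m) * expPartial (ι m * ⅕) N)           ≤⟨ *-monoˡ (0≤/ 5 0) (partial-bound m N) ⟩
    ι 5 * ι (5 ℕ.^ m)                                      ≡⟨ ι-* 5 (5 ℕ.^ m) ⟨
    ι (5 ℕ.* 5 ℕ.^ m)                                      ∎
    where
    open +-*-Solver
    next : ι (suc m) * ⅕ ≡ ι m * ⅕ + ⅕
    next = trans (cong (_* ⅕) (ι-+ 1 m)) (solve 2 (λ i f → (con 1ℚ :+ i) :* f := i :* f :+ f) refl (ι m) ⅕)
    swap : ∀ a b c → a * b * c ≡ b * (a * c)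
    swap = solve 3 (λ a b c → a :* b :* c := b :* (a :* c)) refl
    swap′ : ∀ a b c → a * (b * c) ≡ b * (a * c)
    swap′ = solve 3 (λ a b c → a :* (b :* c) := b :* (a :* c)) refl

  -- The only passage from logarithms to powers: a partial sum above s means log s < y ≤ m/5, and
  -- then s (4/5)^m < 1.
  exceeds⇒power : ∀ {y s m N} → 0ℚ ≤ y → y ≤ ι m * ⅕ → ι s ℚ.< expPartial y N → 4 ℕ.^ m ℕ.* s ℕ.< 5 ℕ.^ m
  exceeds⇒power {y} {s} {m} {N} 0≤y y≤ s<exp = ι-cancel-< (begin-strict
    ι (4 ℕ.^ m ℕ.* s)                     ≡⟨ ι-* (4 ℕ.^ m) s ⟩
    ι (4 ℕ.^ m) * ι s                     <⟨ ℚ.*-monoʳ-<-pos (ι (4 ℕ.^ m)) ⦃ ℚ.positive 0<4^m ⦄ s<exp ⟩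
    ι (4 ℕ.^ m) * expPartial y N          ≤⟨ *-monoˡ (0≤/ (4 ℕ.^ m) 0) (partial-mono 0≤y y≤ N) ⟩
    ι (4 ℕ.^ m) * expPartial (ι m * ⅕) N  ≤⟨ partial-bound m N ⟩
    ι (5 ℕ.^ m)                           ∎)
    where
    0<4^m : 0ℚ ℚ.< ι (4 ℕ.^ m)
    0<4^m = ι-mono-< (ℕ.m^n>0 4 m)

-- Finite sums and vertex sets

open import Data.Nat using (_≤_; _<_; _*_; _+_; _∸_; _^_; z≤n; s≤s; _⊓_; _<ᵇ_)

-- Certificate for linear arithmetic: the hypotheses are combined into p ≤ q, and what remains is
-- an identity for the ring solver.
by-adding : ∀ {p q a b} r → p ≤ q → b + p ≡ a + q + r → a ≤ b
by-adding {p} {q} {a} {b} r p≤q eq = +-cancelʳ-≤ q a b (begin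
  a + q      ≤⟨ m≤m+n (a + q) r ⟩
  a + q + r  ≡⟨ eq ⟨
  b + p      ≤⟨ +-monoʳ-≤ b p≤q ⟩
  b + q      ∎)
  where open ≤-Reasoning

∑-mono : ∀ {n} {f g : Fin n → ℕ} → (∀ i → f i ≤ g i) → sum f ≤ sum g
∑-mono {zero}  f≤g = z≤n
∑-mono {suc n} f≤g = +-mono-≤ (f≤g zero) (∑-mono (f≤g ∘ suc))

∑-strict : ∀ {n} {f g : Fin n → ℕ} → (∀ i → f i ≤ g i) → ∀ j → f j < g j → sum f < sum g
∑-strict {suc n} f≤g zero    lt = +-mono-<-≤ lt (∑-mono (f≤g ∘ suc))
∑-strict {suc n} f≤g (suc j) lt = +-mono-≤-< (f≤g zero) (∑-strict (f≤g ∘ suc) j lt)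

term≤∑ : ∀ {n} (f : Fin n → ℕ) i → f i ≤ sum f
term≤∑ f zero    = m≤m+n _ _
term≤∑ f (suc i) = ≤-trans (term≤∑ (f ∘ suc) i) (m≤n+m _ _)

∑-zero : ∀ {n} {f : Fin n → ℕ} → (∀ i → f i ≡ 0) → sum f ≡ 0
∑-zero {zero}  f≡0 = refl
∑-zero {suc n} f≡0 = cong₂ _+_ (f≡0 zero) (∑-zero (f≡0 ∘ suc))

∑≡0⇒≡0 : ∀ {n} (f : Fin n → ℕ) → sum f ≡ 0 → ∀ i → f i ≡ 0
∑≡0⇒≡0 f eq i = n≤0⇒n≡0 (≤-trans (term≤∑ f i) (≤-reflexive eq))

∑-positive : ∀ {n} (f : Fin n → ℕ) → 0 < sum f → ∃ λ i → 0 < f i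
∑-positive {suc n} f pos with f zero in eq
... | suc _ = zero , subst (0 <_) (sym eq) (s≤s z≤n)
... | zero  with ∑-positive (f ∘ suc) pos
...   | i , fi = suc i , fi

∑-const-1 : ∀ n → sum {n} (λ _ → 1) ≡ n
∑-const-1 zero    = refl
∑-const-1 (suc n) = cong suc (∑-const-1 n)

⟦_⟧ : Bool → ℕ
⟦ b ⟧ = if b then 1 else 0

⟦⟧≤1 : ∀ b → ⟦ b ⟧ ≤ 1
⟦⟧≤1 true  = ≤-refl
⟦⟧≤1 false = z≤n

⟦⟧-positive : ∀ {b} → 0 < ⟦ b ⟧ → b ≡ true
⟦⟧-positive {true} _ = refl

_==_ : ∀ {n} → Fin n → Fin n → Bool
u == v = does (u Fin.≟ v)

==-refl : ∀ {n} (u : Fin n) → u == u ≡ true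
==-refl u with u Fin.≟ u
... | yes _ = refl
... | no ne = ⊥-elim (ne refl)

==-sound : ∀ {n} {u v : Fin n} → u == v ≡ true → u ≡ v
==-sound {u = u} {v} eq with u Fin.≟ v
... | yes p = p

==-≢ : ∀ {n} {u v : Fin n} → u ≢ v → u == v ≡ false
==-≢ {u = u} {v} ne with u Fin.≟ v
... | yes p = ⊥-elim (ne p)
... | no _  = refl

∑-δ : ∀ {n} (x : Fin n) (f : Fin n → ℕ) → sum (λ u → ⟦ u == x ⟧ * f u) ≡ f x
∑-δ {suc n} zero f = trans (cong (1 * f zero ℕ.+_) (∑-zero {f = λ u → ⟦ suc u == zero ⟧ * f (suc u)} λ _ → refl))
  (trans (+-identityʳ _) (*-identityˡ _))
∑-δ {suc n} (suc x) f = ∑-δ x (f ∘ suc)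

Mask : ℕ → Set
Mask n = Fin n → Bool

∣_∣ₘ : ∀ {n} → Mask n → ℕ
∣ M ∣ₘ = sum (λ v → ⟦ M v ⟧)

mask-empty : ∀ {n} (M : Mask n) → ∣ M ∣ₘ ≡ 0 → ∀ v → M v ≡ false
mask-empty M eq v with M v | ∑≡0⇒≡0 (⟦_⟧ ∘ M) eq v
... | false | _ = refl

mask-member : ∀ {n} (M : Mask n) → 0 < ∣ M ∣ₘ → ∃ λ v → M v ≡ true
mask-member M pos with ∑-positive (⟦_⟧ ∘ M) pos
... | v , p = v , ⟦⟧-positive p

member⇒positive : ∀ {n} (M : Mask n) {v} → M v ≡ true → 0 < ∣ M ∣ₘ
member⇒positive M {v} Mv = ≤-trans (≤-reflexive (cong ⟦_⟧ (sym Mv))) (term≤∑ (⟦_⟧ ∘ M) v)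

∣∣-mono : ∀ {n} {M N : Mask n} → (∀ v → M v ≡ true → N v ≡ true) → ∣ M ∣ₘ ≤ ∣ N ∣ₘ
∣∣-mono {M = M} {N} M⊆N = ∑-mono λ v → pointwise (M v) (N v) (M⊆N v)
  where
  pointwise : ∀ a b → (a ≡ true → b ≡ true) → ⟦ a ⟧ ≤ ⟦ b ⟧
  pointwise false b i = z≤n
  pointwise true  b i = ≤-reflexive (cong ⟦_⟧ (sym (i refl)))

∣∣-split : ∀ {n} (M N : Mask n) → ∣ M ∣ₘ ≡ ∣ (λ v → M v ∧ N v) ∣ₘ + ∣ (λ v → M v ∧ not (N v)) ∣ₘ
∣∣-split M N = trans (sum-cong-≗ λ v → pointwise (M v) (N v))
                     (∑-distrib-+ (λ v → ⟦ M v ∧ N v ⟧) (λ v → ⟦ M v ∧ not (N v) ⟧))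
  where
  pointwise : ∀ a b → ⟦ a ⟧ ≡ ⟦ a ∧ b ⟧ + ⟦ a ∧ not b ⟧
  pointwise false b     = refl
  pointwise true  false = refl
  pointwise true  true  = refl

∣∣-∨ : ∀ {n} (M N : Mask n) → ∣ (λ v → M v ∨ N v) ∣ₘ ≤ ∣ M ∣ₘ + ∣ N ∣ₘ
∣∣-∨ M N = ≤-trans (∑-mono λ v → pointwise (M v) (N v))
                   (≤-reflexive (∑-distrib-+ (⟦_⟧ ∘ M) (⟦_⟧ ∘ N)))
  where
  pointwise : ∀ a b → ⟦ a ∨ b ⟧ ≤ ⟦ a ⟧ + ⟦ b ⟧
  pointwise false b = ≤-refl
  pointwise true  b = m≤m+n 1 _

∣∣-singleton : ∀ {n} (x : Fin n) → ∣ (λ v → v == x) ∣ₘ ≡ 1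
∣∣-singleton {n} x = trans (sum-cong-≗ {n} λ v → sym (*-identityʳ ⟦ v == x ⟧)) (∑-δ x (λ _ → 1))

-- Otherwise f > g on all of the nonempty `M`, and the two sums would compare strictly the other
-- way.
averaging : ∀ {n} (M : Mask n) (f g : Fin n → ℕ) → 0 < ∣ M ∣ₘ →
            sum (λ v → ⟦ M v ⟧ * f v) ≤ sum (λ v → ⟦ M v ⟧ * g v) →
            ∃ λ v → M v ≡ true × f v ≤ g v
averaging M f g pos le with any? (λ v → (M v Bool.≟ true) ×-dec (f v ℕ.≤? g v))
... | yes p = p
... | no ∄  = ⊥-elim (<⇒≱ (∑-strict mono (proj₁ member) strict) le)
  where
  member = mask-member M pos
  mono : ∀ v → ⟦ M v ⟧ * g v ≤ ⟦ M v ⟧ * f v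
  mono v with M v in eq
  ... | false = z≤n
  ... | true  = *-monoʳ-≤ 1 (<⇒≤ (≰⇒> λ f≤g → ∄ (v , eq , f≤g)))
  strict : ⟦ M (proj₁ member) ⟧ * g (proj₁ member) < ⟦ M (proj₁ member) ⟧ * f (proj₁ member)
  strict rewrite proj₂ member =
    *-monoʳ-< 1 (≰⇒> λ f≤g → ∄ (proj₁ member , proj₂ member , f≤g))

-- Weighted edge counts: for masks U and W this is the number of pairs (u , w) ∈ U × W with
-- u adjacent to w, so edges inside U ∩ W are counted twice.
E : ∀ {n} → Graph n → (Fin n → ℕ) → (Fin n → ℕ) → ℕ
E G f g = sum λ u → f u * sum λ v → ⟦ adj G u v ⟧ * g v

module _ {n} (G : Graph n) where

  E-congˡ : ∀ {f f′} g → (∀ v → f v ≡ f′ v) → E G f g ≡ E G f′ g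
  E-congˡ g f≡ = sum-cong-≗ λ v → cong (_* _) (f≡ v)

  E-+ˡ : ∀ f f′ g → E G (λ v → f v + f′ v) g ≡ E G f g + E G f′ g
  E-+ˡ f f′ g = trans (sum-cong-≗ λ u → *-distribʳ-+ _ (f u) (f′ u)) (∑-distrib-+ (λ u → f u * _) (λ u → f′ u * _))

  E-comm : ∀ f g → E G f g ≡ E G g f
  E-comm f g = begin
    E G f g                                              ≡⟨ sum-cong-≗ {n} (λ u → *-distribˡ-sum {n} (f u) (λ v → ⟦ adj G u v ⟧ * g v)) ⟩
    sum (λ u → sum λ v → f u * (⟦ adj G u v ⟧ * g v))    ≡⟨ ∑-comm {n} {n} (λ u v → f u * (⟦ adj G u v ⟧ * g v)) ⟩
    sum (λ v → sum λ u → f u * (⟦ adj G u v ⟧ * g v))    ≡⟨ sum-cong-≗ {n} (λ v → sum-cong-≗ {n} λ u → swap u v) ⟩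
    sum (λ v → sum λ u → g v * (⟦ adj G v u ⟧ * f u))    ≡⟨ sum-cong-≗ {n} (λ v → *-distribˡ-sum {n} (g v) (λ u → ⟦ adj G v u ⟧ * f u)) ⟨
    E G g f                                              ∎
    where
    open ≡-Reasoning
    rotate : ∀ a b c → a * (b * c) ≡ c * (b * a)
    rotate = solve-∀
    swap : ∀ u v → f u * (⟦ adj G u v ⟧ * g v) ≡ g v * (⟦ adj G v u ⟧ * f u)
    swap u v rewrite symm G u v = rotate (f u) ⟦ adj G v u ⟧ (g v)

  E-congʳ : ∀ f {g g′} → (∀ v → g v ≡ g′ v) → E G f g ≡ E G f g′
  E-congʳ f {g} {g′} g≡ = trans (E-comm f g) (trans (E-congˡ f g≡) (E-comm g′ f))

  E-+ʳ : ∀ f g g′ → E G f (λ v → g v + g′ v) ≡ E G f g + E G f g′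
  E-+ʳ f g g′ = trans (E-comm f _) (trans (E-+ˡ g g′ f) (cong₂ _+_ (E-comm g f) (E-comm g′ f)))

  E-square : ∀ {f} g h → (∀ v → f v ≡ g v + h v) → E G f f ≡ E G g g + 2 * E G g h + E G h h
  E-square {f} g h f≡ = begin
    E G f f                                          ≡⟨ trans (E-congˡ f f≡) (E-congʳ (λ v → g v + h v) f≡) ⟩
    E G (λ v → g v + h v) (λ v → g v + h v)          ≡⟨ E-+ˡ g h _ ⟩
    E G g (λ v → g v + h v) + E G h (λ v → g v + h v) ≡⟨ cong₂ _+_ (E-+ʳ g g h) (E-+ʳ h g h) ⟩
    E G g g + E G g h + (E G h g + E G h h)          ≡⟨ cong (λ z → E G g g + E G g h + (z + E G h h)) (E-comm h g) ⟩
    E G g g + E G g h + (E G g h + E G h h)          ≡⟨ regroup (E G g g) (E G g h) (E G h h) ⟩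
    E G g g + 2 * E G g h + E G h h                  ∎
    where
    open ≡-Reasoning
    regroup : ∀ a b c → a + b + (b + c) ≡ a + 2 * b + c
    regroup = solve-∀

  E≤product : ∀ f g → E G f g ≤ sum f * sum g
  E≤product f g = begin
    E G f g                    ≤⟨ ∑-mono (λ u → *-monoʳ-≤ (f u) (∑-mono λ v → ≤-trans (*-monoˡ-≤ (g v) (⟦⟧≤1 (adj G u v))) (≤-reflexive (*-identityˡ (g v))))) ⟩
    sum (λ u → f u * sum g)    ≡⟨ *-distribʳ-sum (sum g) f ⟨
    sum f * sum g              ∎
    where open ≤-Reasoning

-- Branch sets

∧-elimˡ : ∀ {a b} → a ∧ b ≡ true → a ≡ true
∧-elimˡ {true} _ = refl

∧-elimʳ : ∀ {a b} → a ∧ b ≡ true → b ≡ true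
∧-elimʳ {true} eq = eq

not-elim : ∀ {a} → not a ≡ true → a ≡ false
not-elim {false} _ = refl

∨-elim : ∀ {a b} → a ∨ b ≡ true → a ≡ true ⊎ b ≡ true
∨-elim {true}  eq = inj₁ refl
∨-elim {false} eq = inj₂ eq

∨-introˡ : ∀ {a b} → a ≡ true → a ∨ b ≡ true
∨-introˡ refl = refl

∨-introʳ : ∀ {a b} → b ≡ true → a ∨ b ≡ true
∨-introʳ {true}  eq = refl
∨-introʳ {false} eq = eq

∨-falseˡ : ∀ {a b} → a ∨ b ≡ false → a ≡ false
∨-falseˡ {false} eq = refl

∨-falseʳ : ∀ {a b} → a ∨ b ≡ false → b ≡ false
∨-falseʳ {false} eq = eq

module _ {n} {G : Graph n} where

  path-map : ∀ {P Q : Fin n → Set} → (∀ {w} → P w → Q w) → ∀ {u v} → PathIn G P u v → PathIn G Q u v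
  path-map f (here p)     = here (f p)
  path-map f (step p a r) = step (f p) a (path-map f r)

  path-++ : ∀ {P u v w} → PathIn G P u v → PathIn G P v w → PathIn G P u w
  path-++ (here p)     q = q
  path-++ (step p a r) q = step p a (path-++ r q)

  path-snoc : ∀ {P u v w} → PathIn G P u v → adj G v w ≡ true → P w → PathIn G P u w
  path-snoc (here p)     a q = step p a (here q)
  path-snoc (step p b r) a q = step p b (path-snoc r a q)

Connected : ∀ {n} → Graph n → Mask n → Set
Connected G A = ∀ u v → A u ≡ true → A v ≡ true → PathIn G (λ w → A w ≡ true) u v

singleton : ∀ {n} → Fin n → Mask n
singleton z v = v == z

insert : ∀ {n} → Fin n → Mask n → Mask n
insert z A v = A v ∨ singleton z v

∣insert∣ : ∀ {n} (z : Fin n) A → ∣ insert z A ∣ₘ ≤ suc ∣ A ∣ₘ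
∣insert∣ z A = begin
  ∣ insert z A ∣ₘ                ≤⟨ ∣∣-∨ A (singleton z) ⟩
  ∣ A ∣ₘ + ∣ singleton z ∣ₘ      ≡⟨ cong (∣ A ∣ₘ ℕ.+_) (∣∣-singleton z) ⟩
  ∣ A ∣ₘ + 1                     ≡⟨ +-comm ∣ A ∣ₘ 1 ⟩
  suc ∣ A ∣ₘ                     ∎
  where open ≤-Reasoning

module _ {n} (G : Graph n) where

  singleton-connected : ∀ z → Connected G (singleton z)
  singleton-connected z u v Au Av with ==-sound {u = u} Au | ==-sound {u = v} Av
  ... | refl | refl = here Au

  insert-connected : ∀ {A w z} → Connected G A → A w ≡ true → adj G w z ≡ true → Connected G (insert z A)
  insert-connected {A} {w} {z} conn Aw w~z u v Iu Iv with ∨-elim {A u} Iu | ∨-elim {A v} Iv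
  ... | inj₁ Au | inj₁ Av = path-map ∨-introˡ (conn u v Au Av)
  ... | inj₁ Au | inj₂ v=z rewrite ==-sound {u = v} v=z =
        path-snoc (path-map ∨-introˡ (conn u w Au Aw)) w~z Iv
  ... | inj₂ u=z | inj₁ Av rewrite ==-sound {u = u} u=z =
        step Iu (trans (symm G z w) w~z) (path-map ∨-introˡ (conn w v Aw Av))
  ... | inj₂ u=z | inj₂ v=z rewrite ==-sound {u = u} u=z | ==-sound {u = v} v=z = here Iu

Disjoint : ∀ {n} → Mask n → Mask n → Set
Disjoint A X = ∀ v → A v ≡ true → X v ≡ false

true≢false : ∀ {b} → b ≡ true → b ≡ false → ⊥
true≢false refl ()

∣∣-difference : ∀ {n} (M Y : Mask n) {m x} → m ≤ ∣ M ∣ₘ → ∣ Y ∣ₘ ≤ x → m ∸ x ≤ ∣ (λ v → M v ∧ not (Y v)) ∣ₘ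
∣∣-difference M Y {m} {x} m≤ ≤x = m≤n+o⇒m∸n≤o m x (begin
  m                                                               ≤⟨ m≤ ⟩
  ∣ M ∣ₘ                                                          ≡⟨ ∣∣-split M Y ⟩
  ∣ (λ v → M v ∧ Y v) ∣ₘ + ∣ (λ v → M v ∧ not (Y v)) ∣ₘ           ≤⟨ +-monoˡ-≤ _ (∣∣-mono {M = λ v → M v ∧ Y v} {Y} λ v → ∧-elimʳ {M v}) ⟩
  ∣ Y ∣ₘ + ∣ (λ v → M v ∧ not (Y v)) ∣ₘ                           ≤⟨ +-monoˡ-≤ _ ≤x ⟩
  x + ∣ (λ v → M v ∧ not (Y v)) ∣ₘ                                ∎)
  where open ≤-Reasoning

∣∣-∨-budget : ∀ {n} (X A : Mask n) k {c} → ∣ A ∣ₘ ≤ c → ∣ (λ v → X v ∨ A v) ∣ₘ + k * c ≤ ∣ X ∣ₘ + suc k * c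
∣∣-∨-budget X A k {c} A≤c = begin
  ∣ (λ v → X v ∨ A v) ∣ₘ + k * c  ≤⟨ +-monoˡ-≤ (k * c) (≤-trans (∣∣-∨ X A) (+-monoʳ-≤ ∣ X ∣ₘ A≤c)) ⟩
  ∣ X ∣ₘ + c + k * c              ≡⟨ +-assoc ∣ X ∣ₘ c (k * c) ⟩
  ∣ X ∣ₘ + suc k * c              ∎
  where open ≤-Reasoning

-- Greedy choice: each new set avoids `X` and all earlier sets, and the budget `m` always leaves
-- room for one more set of size `c`. The mask `Z` contains everything used, so that a second family
-- can be chosen away from the first.
disjoint-family : ∀ {n} (Q : Mask n → Set) (c m k : ℕ) (X : Mask n) → ∣ X ∣ₘ + k * c ≤ m →
  (∀ Y → ∣ Y ∣ₘ + c ≤ m → ∃ λ A → Q A × Disjoint A Y × ∣ A ∣ₘ ≤ c) →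
  ∃₂ λ (F : Fin k → Mask n) (Z : Mask n) →
    (∀ i → Q (F i)) × (∀ i → Disjoint (F i) X) ×
    (∀ i j v → F i v ≡ true → F j v ≡ true → i ≡ j) ×
    (∀ v → X v ≡ true → Z v ≡ true) × (∀ i v → F i v ≡ true → Z v ≡ true) × ∣ Z ∣ₘ ≤ ∣ X ∣ₘ + k * c
disjoint-family Q c m zero X le pick =
  (λ ()) , X , (λ ()) , (λ ()) , (λ ()) , (λ _ Xv → Xv) , (λ ()) , m≤m+n _ _
disjoint-family {n} Q c m (suc k) X le pick
  with pick X (≤-trans (+-monoʳ-≤ ∣ X ∣ₘ (m≤m+n c (k * c))) le)
... | A , QA , A∩X , A≤c
  with disjoint-family Q c m k (λ v → X v ∨ A v) (≤-trans (∣∣-∨-budget X A k A≤c) le) pick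
... | F , Z , QF , F∩X , unique , X⊆Z , F⊆Z , Z≤ =
  F′ , Z , Q′ , disj′ , unique′ , (λ v Xv → X⊆Z v (∨-introˡ Xv)) , ⊆′ , ≤-trans Z≤ (∣∣-∨-budget X A k A≤c)
  where
  F′ : Fin (suc k) → Mask n
  F′ zero    = A
  F′ (suc i) = F i
  Q′ : ∀ i → Q (F′ i)
  Q′ zero    = QA
  Q′ (suc i) = QF i
  disj′ : ∀ i → Disjoint (F′ i) X
  disj′ zero    v Av = A∩X v Av
  disj′ (suc i) v Fv = ∨-falseˡ (F∩X i v Fv)
  unique′ : ∀ i j v → F′ i v ≡ true → F′ j v ≡ true → i ≡ j
  unique′ zero    zero    v p q = refl
  unique′ zero    (suc j) v p q = ⊥-elim (true≢false p (∨-falseʳ {X v} (F∩X j v q)))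
  unique′ (suc i) zero    v p q = ⊥-elim (true≢false q (∨-falseʳ {X v} (F∩X i v p)))
  unique′ (suc i) (suc j) v p q = cong suc (unique i j v p q)
  ⊆′ : ∀ i v → F′ i v ≡ true → Z v ≡ true
  ⊆′ zero    v p = X⊆Z v (∨-introʳ {X v} p)
  ⊆′ (suc i) v p = F⊆Z i v p

module _ {n s t} (G : Graph n) (M : Fin s ⊎ Fin t → Mask n)
         (unique : ∀ b b′ v → M b v ≡ true → M b′ v ≡ true → b ≡ b′) where

  private
    find : ∀ v → Dec (∃ λ b → M b v ≡ true)
    find v with any? (λ i → M (inj₁ i) v Bool.≟ true) | any? (λ j → M (inj₂ j) v Bool.≟ true)
    ... | yes (i , p) | _           = yes (inj₁ i , p)
    ... | no _        | yes (j , p) = yes (inj₂ j , p)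
    ... | no ∄₁       | no ∄₂       = no λ { (inj₁ i , p) → ∄₁ (i , p) ; (inj₂ j , p) → ∄₂ (j , p) }

    label : Fin n → Maybe (Fin s ⊎ Fin t)
    label v with find v
    ... | yes (b , _) = just b
    ... | no _        = nothing

    label-sound : ∀ {v b} → label v ≡ just b → M b v ≡ true
    label-sound {v} eq with find v
    label-sound refl | yes (b , p) = p

    label-complete : ∀ {v b} → M b v ≡ true → label v ≡ just b
    label-complete {v} {b} p with find v
    ... | yes (b′ , p′) = cong just (unique b′ b v p′ p)
    ... | no ∄          = ⊥-elim (∄ (b , p))

  -- `label` takes the first set found to contain a vertex; since the sets are disjoint, this agrees
  -- with membership in every one of them.
  minor-from-sets : (∀ b → ∃ λ v → M b v ≡ true) → (∀ b → Connected G (M b)) →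
    (∀ a c → ∃₂ λ u v → M (inj₁ a) u ≡ true × M (inj₂ c) v ≡ true × adj G u v ≡ true) →
    HasKstMinor s t G
  minor-from-sets nonempty connected adjacent = record
    { branch    = label
    ; nonempty  = λ b → proj₁ (nonempty b) , label-complete (proj₂ (nonempty b))
    ; connected = λ b u v pu pv → path-map label-complete (connected b u v (label-sound pu) (label-sound pv))
    ; adjacent  = λ a c → let (u , v , pu , pv , u~v) = adjacent a c in
                  u , v , label-complete pu , label-complete pv , u~v
    }

-- Small connected sets that dominate almost everything

-- This is the inner sum of `E G f (⟦_⟧ ∘ U)`, so that averaging an edge count yields a single
-- vertex with a large value.
cover : ∀ {n} → Graph n → Mask n → Fin n → ℕ
cover G U z = sum λ v → ⟦ adj G z v ⟧ * ⟦ U v ⟧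

cover-split : ∀ {n} (G : Graph n) U z → ∣ U ∣ₘ ≡ cover G U z + ∣ (λ v → U v ∧ not (adj G z v)) ∣ₘ
cover-split {n} G U z = trans (∣∣-split U (adj G z)) (cong (_+ ∣ (λ v → U v ∧ not (adj G z v)) ∣ₘ) (sum-cong-≗ {n} λ v → pointwise (U v) (adj G z v)))
  where
  pointwise : ∀ a b → ⟦ a ∧ b ⟧ ≡ ⟦ b ⟧ * ⟦ a ⟧
  pointwise false false = refl
  pointwise false true  = refl
  pointwise true  false = refl
  pointwise true  true  = refl

∧-not-false : ∀ a {b} → a ∧ not b ≡ false → a ≡ false ⊎ b ≡ true
∧-not-false false        _ = inj₁ refl
∧-not-false true  {true} _ = inj₂ refl

*-swap : ∀ a b c → a * (b * c) ≡ b * (a * c)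
*-swap = solve-∀

-- Even if all u f pairs on the far side are edges, 40 eᵈ ≥ 15 u d - 25 u f ≥ 8 u d. This is the
-- source of the proportion one fifth.
cut-bound : ∀ u d f eᵈ eᶠ → 3 * (u * (f + d)) ≤ 8 * (eᶠ + eᵈ) → eᶠ ≤ u * f → 25 * f ≤ 7 * d → u * d ≤ 5 * eᵈ
cut-bound u d f eᵈ eᶠ cut few-far small = *-cancelˡ-≤ 8 (by-adding 0
  (+-mono-≤ (+-mono-≤ (*-monoʳ-≤ 5 cut) (*-monoʳ-≤ 40 few-far)) (*-monoʳ-≤ u small))
  (lemma u d f eᵈ eᶠ))
  where
  lemma : ∀ u d f e g → 8 * (5 * e) + (5 * (3 * (u * (f + d))) + 40 * g + u * (25 * f))
                      ≡ 8 * (u * d) + (5 * (8 * (g + e)) + 40 * (u * f) + u * (7 * d)) + 0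
  lemma = solve-∀

geometric-step : ∀ {a b j p p′ r} → a * p′ ≤ b * p → a ^ j * p ≤ b ^ j * r → a ^ suc j * p′ ≤ b ^ suc j * r
geometric-step {a} {b} {j} {p} {p′} {r} shrink bound = begin
  a * a ^ j * p′    ≡⟨ swap₁ a (a ^ j) p′ ⟩
  a ^ j * (a * p′)  ≤⟨ *-monoʳ-≤ (a ^ j) shrink ⟩
  a ^ j * (b * p)   ≡⟨ swap₂ (a ^ j) b p ⟩
  b * (a ^ j * p)   ≤⟨ *-monoʳ-≤ b bound ⟩
  b * (b ^ j * r)   ≡⟨ *-assoc b (b ^ j) r ⟨
  b * b ^ j * r     ∎
  where
  open ≤-Reasoning
  swap₁ : ∀ x y z → x * y * z ≡ y * (x * z)
  swap₁ = solve-∀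
  swap₂ : ∀ x y z → x * (y * z) ≡ y * (x * z)
  swap₂ = solve-∀

module Greedy {n} (G : Graph n) (S : Mask n) (δ : ℕ)
  (δ≤deg : ∀ z → S z ≡ true → δ ≤ ∣ (λ v → S v ∧ adj G z v) ∣ₘ)
  (δ≤∣S∣ : δ ≤ ∣ S ∣ₘ)
  (cut : ∀ U W → (∀ v → ⟦ S v ⟧ ≡ ⟦ U v ⟧ + ⟦ W v ⟧) → 3 * (∣ U ∣ₘ * ∣ W ∣ₘ) ≤ 8 * E G (⟦_⟧ ∘ U) (⟦_⟧ ∘ W))
  where

  -- One vertex leaves at most |S| - δ vertices undominated, and each of the `j` later ones
  -- multiplies this by at most 4/5. The field `few` says that at least δ vertices of `S` are
  -- dominated, which is the supply for the next step.
  record Dominator (j : ℕ) (X : Mask n) : Set where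
    field
      set undominated : Mask n
      disjoint   : Disjoint set X
      size       : ∣ set ∣ₘ ≤ suc j
      member     : ∃ λ v → set v ≡ true
      conn       : Connected G set
      within     : ∀ v → undominated v ≡ true → S v ≡ true
      dominates  : ∀ v → S v ≡ true → undominated v ≡ false → ∃ λ u → set u ≡ true × adj G u v ≡ true
      few        : ∣ undominated ∣ₘ + δ ≤ ∣ S ∣ₘ
      decay      : 5 ^ j * ∣ undominated ∣ₘ ≤ 4 ^ j * (∣ S ∣ₘ ∸ δ)

  dominator-start : ∀ X z → S z ≡ true → X z ≡ false → Dominator 0 X
  dominator-start X z z∈S z∉X = record
    { set         = singleton z
    ; undominated = U
    ; disjoint    = λ v v=z → subst (λ w → X w ≡ false) (sym (==-sound {u = v} v=z)) z∉X
    ; size        = ≤-reflexive (∣∣-singleton z)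
    ; member      = z , ==-refl z
    ; conn        = singleton-connected G z
    ; within      = λ v → ∧-elimˡ
    ; dominates   = λ v Sv ¬Uv → z , ==-refl z , adjacent v Sv (∧-not-false (S v) ¬Uv)
    ; few         = U+δ≤S
    ; decay       = *-monoʳ-≤ 1 (m+n≤o⇒m≤o∸n ∣ U ∣ₘ U+δ≤S)
    }
    where
    U : Mask n
    U v = S v ∧ not (adj G z v)
    U+δ≤S : ∣ U ∣ₘ + δ ≤ ∣ S ∣ₘ
    U+δ≤S = begin
      ∣ U ∣ₘ + δ                                      ≤⟨ +-monoʳ-≤ ∣ U ∣ₘ (δ≤deg z z∈S) ⟩
      ∣ U ∣ₘ + ∣ (λ v → S v ∧ adj G z v) ∣ₘ           ≡⟨ +-comm ∣ U ∣ₘ _ ⟩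
      ∣ (λ v → S v ∧ adj G z v) ∣ₘ + ∣ U ∣ₘ           ≡⟨ ∣∣-split S (adj G z) ⟨
      ∣ S ∣ₘ                                          ∎
      where open ≤-Reasoning
    adjacent : ∀ v → S v ≡ true → S v ≡ false ⊎ adj G z v ≡ true → adj G z v ≡ true
    adjacent v Sv (inj₁ ¬Sv) = ⊥-elim (true≢false Sv ¬Sv)
    adjacent v Sv (inj₂ z~v) = z~v

  -- Averaging over the dominated vertices outside X, some one of them dominates at least a fifth of
  -- what is left, and adding it keeps the set connected.
  module Grow {j X} (𝒜 : Dominator j X) where
    open Dominator 𝒜

    U Y W near far : Mask n
    U = undominated
    Y v = X v ∨ set v
    W v = S v ∧ not (U v)
    -- Both are sets of dominated vertices: `near` those still available, `far` those forbidden or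
    -- already in the set.
    near v = W v ∧ not (Y v)
    far v = W v ∧ Y v

    S=U+W : ∀ v → ⟦ S v ⟧ ≡ ⟦ U v ⟧ + ⟦ W v ⟧
    S=U+W v = pointwise (S v) (U v) (within v)
      where
      pointwise : ∀ a b → (b ≡ true → a ≡ true) → ⟦ a ⟧ ≡ ⟦ b ⟧ + ⟦ a ∧ not b ⟧
      pointwise true  true  _   = refl
      pointwise true  false _   = refl
      pointwise false false _   = refl
      pointwise false true  b⇒a with b⇒a refl
      ... | ()

    W=far+near : ∀ v → ⟦ W v ⟧ ≡ ⟦ far v ⟧ + ⟦ near v ⟧
    W=far+near v = pointwise (W v) (Y v)
      where
      pointwise : ∀ a b → ⟦ a ⟧ ≡ ⟦ a ∧ b ⟧ + ⟦ a ∧ not b ⟧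
      pointwise false b     = refl
      pointwise true  false = refl
      pointwise true  true  = refl

    ∣S∣≡ : ∣ S ∣ₘ ≡ ∣ U ∣ₘ + ∣ W ∣ₘ
    ∣S∣≡ = trans (sum-cong-≗ {n} S=U+W) (∑-distrib-+ (⟦_⟧ ∘ U) (⟦_⟧ ∘ W))

    δ≤W : δ ≤ ∣ far ∣ₘ + ∣ near ∣ₘ
    δ≤W = ≤-trans (+-cancelˡ-≤ ∣ U ∣ₘ δ ∣ W ∣ₘ (≤-trans few (≤-reflexive ∣S∣≡))) (≤-reflexive (∣∣-split W Y))

    best : ∀ {x} → 0 < x → 5 * x ≤ δ → ∣ X ∣ₘ + suc j ≤ x →
           ∃ λ z → near z ≡ true × ∣ U ∣ₘ ≤ 5 * cover G U z
    best {x} 0<x 5x≤δ budget = averaging near (λ _ → u) (λ v → 5 * cover G U v)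
      (≤-trans (≤-trans 0<x (m≤m+n x (3 * x))) 4x≤near) (begin
        sum (λ v → ⟦ near v ⟧ * u)               ≡⟨ *-distribʳ-sum {n} u (⟦_⟧ ∘ near) ⟨
        d * u                                    ≡⟨ *-comm d u ⟩
        u * d                                    ≤⟨ cut-bound u d f eᵈ eᶠ cutW (E≤product G (⟦_⟧ ∘ U) (⟦_⟧ ∘ far)) 25f≤7d ⟩
        5 * eᵈ                                   ≡⟨ cong (5 *_) (E-comm G (⟦_⟧ ∘ U) (⟦_⟧ ∘ near)) ⟩
        5 * E G (⟦_⟧ ∘ near) (⟦_⟧ ∘ U)           ≡⟨ *-distribˡ-sum {n} 5 (λ v → ⟦ near v ⟧ * cover G U v) ⟩
        sum (λ v → 5 * (⟦ near v ⟧ * cover G U v)) ≡⟨ sum-cong-≗ {n} (λ v → *-swap 5 ⟦ near v ⟧ (cover G U v)) ⟩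
        sum (λ v → ⟦ near v ⟧ * (5 * cover G U v)) ∎)
      where
      open ≤-Reasoning
      u d f eᵈ eᶠ : ℕ
      u = ∣ U ∣ₘ
      d = ∣ near ∣ₘ
      f = ∣ far ∣ₘ
      eᵈ = E G (⟦_⟧ ∘ U) (⟦_⟧ ∘ near)
      eᶠ = E G (⟦_⟧ ∘ U) (⟦_⟧ ∘ far)
      far≤x : f ≤ x
      far≤x = ≤-trans (∣∣-mono {M = far} {Y} λ v → ∧-elimʳ {W v})
             (≤-trans (∣∣-∨ X set) (≤-trans (+-monoʳ-≤ ∣ X ∣ₘ size) budget))
      4x≤near : 4 * x ≤ d
      4x≤near = by-adding 0 (+-mono-≤ (≤-trans 5x≤δ δ≤W) far≤x) (lemma x f d)
        where
        lemma : ∀ x f n → n + (5 * x + f) ≡ 4 * x + (f + n + x) + 0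
        lemma = solve-∀
      -- From f ≤ x and 4x ≤ d, because 25x ≤ 28x = 7 · 4x.
      25f≤7d : 25 * f ≤ 7 * d
      25f≤7d = ≤-trans (*-monoʳ-≤ 25 far≤x) (≤-trans (*-monoˡ-≤ x (m≤m+n 25 3)) (≤-trans (≤-reflexive (*-assoc 7 4 x)) (*-monoʳ-≤ 7 4x≤near)))
      cutW : 3 * (u * (f + d)) ≤ 8 * (eᶠ + eᵈ)
      cutW = subst₂ _≤_ (cong (λ w → 3 * (u * w)) (∣∣-split W Y))
        (cong (8 *_) (trans (E-congʳ G (⟦_⟧ ∘ U) W=far+near) (E-+ʳ G (⟦_⟧ ∘ U) (⟦_⟧ ∘ far) (⟦_⟧ ∘ near))))
        (cut U W S=U+W)

    grow : ∀ z → near z ≡ true → ∣ U ∣ₘ ≤ 5 * cover G U z → Dominator (suc j) X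
    grow z z∈near covers = record
      { set         = insert z set
      ; undominated = U′
      ; disjoint    = λ v Iv → disjoint′ v (∨-elim {set v} Iv)
      ; size        = ≤-trans (∣insert∣ z set) (s≤s size)
      ; member      = proj₁ member , ∨-introˡ (proj₂ member)
      ; conn        = insert-connected G conn (proj₁ (proj₂ attach)) (proj₂ (proj₂ attach))
      ; within      = λ v U′v → within v (∧-elimˡ U′v)
      ; dominates   = λ v Sv ¬U′v → dominates′ v Sv (∧-not-false (U v) ¬U′v)
      ; few         = ≤-trans (+-monoˡ-≤ δ (∣∣-mono {M = U′} {U} λ v → ∧-elimˡ)) few
      ; decay       = geometric-step {5} {4} {j} shrink decay
      }
      where
      z∈W : W z ≡ true
      z∈W = ∧-elimˡ z∈near
      z∉Y : Y z ≡ false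
      z∉Y = not-elim (∧-elimʳ {W z} z∈near)
      -- Taking `z` among the dominated vertices is what provides an edge back to the set.
      attach : ∃ λ w → set w ≡ true × adj G w z ≡ true
      attach = dominates z (∧-elimˡ z∈W) (not-elim (∧-elimʳ {S z} z∈W))
      U′ : Mask n
      U′ v = U v ∧ not (adj G z v)
      shrink : 5 * ∣ U′ ∣ₘ ≤ 4 * ∣ U ∣ₘ
      shrink = by-adding 0 covers
        (trans (cong (λ y → 4 * y + y) (cover-split G U z)) (lemma (cover G U z) ∣ U′ ∣ₘ))
        where
        lemma : ∀ c w → 4 * (c + w) + (c + w) ≡ 5 * w + 5 * c + 0
        lemma = solve-∀
      disjoint′ : ∀ v → set v ≡ true ⊎ singleton z v ≡ true → X v ≡ false
      disjoint′ v (inj₁ Av)  = disjoint v Av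
      disjoint′ v (inj₂ v=z) = subst (λ w → X w ≡ false) (sym (==-sound {u = v} v=z)) (∨-falseˡ z∉Y)
      dominates′ : ∀ v → S v ≡ true → U v ≡ false ⊎ adj G z v ≡ true → ∃ λ w → insert z set w ≡ true × adj G w v ≡ true
      dominates′ v Sv (inj₁ ¬Uv) = let (w , Aw , w~v) = dominates v Sv ¬Uv in w , ∨-introˡ Aw , w~v
      dominates′ v Sv (inj₂ z~v) = z , ∨-introʳ {set z} (==-refl z) , z~v

  dominator : ∀ {x} → 0 < x → 5 * x ≤ δ → ∀ j X → ∣ X ∣ₘ + suc j ≤ x → Dominator j X
  dominator {x} 0<x 5x≤δ zero X budget =
    let (z , z∈) = fresh in dominator-start X z (∧-elimˡ z∈) (not-elim (∧-elimʳ {S z} z∈))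
    where
    open ≤-Reasoning
    fresh : ∃ λ v → S v ∧ not (X v) ≡ true
    fresh = mask-member (λ v → S v ∧ not (X v)) (≤-trans (m<n⇒0<n∸m (begin-strict
      ∣ X ∣ₘ      <⟨ m<m+n ∣ X ∣ₘ (s≤s z≤n) ⟩
      ∣ X ∣ₘ + 1  ≤⟨ budget ⟩
      x           ≤⟨ m≤m+n x (4 * x) ⟩
      5 * x       ≤⟨ 5x≤δ ⟩
      δ           ∎)) (∣∣-difference S X δ≤∣S∣ ≤-refl))
  dominator 0<x 5x≤δ (suc j) X budget =
    let (z , z∈near , covers) = best 0<x 5x≤δ budget′ in grow z z∈near covers
    where
    budget′ = ≤-trans (+-monoʳ-≤ ∣ X ∣ₘ (n≤1+n (suc j))) budget
    open Grow (dominator 0<x 5x≤δ j X budget′)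

-- Paths that meet every dominating set

-- A neighbourhood in `S` keeps at least δ ∸ x vertices when x are forbidden, and `few` says that
-- each `U i` fills at most the proportion b/a of such a pool. The intended ratio b/a is a power of
-- 4/5.
module Connector {n s : ℕ} (G : Graph n) (S : Mask n) (δ x : ℕ)
  (δ≤deg : ∀ z → S z ≡ true → δ ≤ ∣ (λ v → S v ∧ adj G z v) ∣ₘ)
  (δ≤∣S∣ : δ ≤ ∣ S ∣ₘ) (x<δ : x < δ)
  (a b : ℕ) (A U : Fin s → Mask n)
  (dominates : ∀ i v → S v ≡ true → U i v ≡ false → ∃ λ u → A i u ≡ true × adj G u v ≡ true)
  (few : ∀ i → a * ∣ U i ∣ₘ ≤ b * (δ ∸ x))
  where

  record Partial (j : ℕ) (X : Mask n) : Set where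
    field
      set      : Mask n
      missed   : Mask s
      tip      : Fin n
      disjoint : Disjoint set X
      size     : ∣ set ∣ₘ ≤ suc j
      tip∈set  : set tip ≡ true
      tip∈S    : S tip ≡ true
      conn     : Connected G set
      meets    : ∀ i → missed i ≡ false → ∃₂ λ u v → A i u ≡ true × set v ≡ true × adj G u v ≡ true
      -- The exponent is `suc j` since the first vertex, chosen from `S` outside `X`, already gains
      -- a factor b/a.
      decay    : a ^ suc j * ∣ missed ∣ₘ ≤ b ^ suc j * s

  -- Every U i is small in the pool P, so some vertex of P lies in few of the U i with i in q.
  pick : (P : Mask n) (q : Mask s) → δ ∸ x ≤ ∣ P ∣ₘ →
         ∃ λ z → P z ≡ true × a * ∣ (λ i → q i ∧ U i z) ∣ₘ ≤ b * ∣ q ∣ₘ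
  pick P q large = averaging P (λ z → a * ∣ (λ i → q i ∧ U i z) ∣ₘ) (λ _ → b * ∣ q ∣ₘ)
    (≤-trans (m<n⇒0<n∸m x<δ) large) (begin
    -- Each `U i` may be counted in full and not only inside `P`, because `few` compares all of it
    -- with δ ∸ x ≤ |P|.
    sum (λ v → ⟦ P v ⟧ * (a * sum (λ i → ⟦ q i ∧ U i v ⟧)))    ≤⟨ ∑-mono (λ v → *-monoˡ-≤ _ (⟦⟧≤1 (P v))) ⟩
    sum (λ v → 1 * (a * sum (λ i → ⟦ q i ∧ U i v ⟧)))          ≡⟨ sum-cong-≗ {n} (λ v → *-identityˡ (a * sum (λ i → ⟦ q i ∧ U i v ⟧))) ⟩
    sum (λ v → a * sum (λ i → ⟦ q i ∧ U i v ⟧))                ≡⟨ *-distribˡ-sum {n} a (λ v → sum (λ i → ⟦ q i ∧ U i v ⟧)) ⟨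
    a * sum (λ v → sum (λ i → ⟦ q i ∧ U i v ⟧))                ≡⟨ cong (a *_) (∑-comm {n} {s} (λ v i → ⟦ q i ∧ U i v ⟧)) ⟩
    a * sum (λ i → sum (λ v → ⟦ q i ∧ U i v ⟧))                ≡⟨ cong (a *_) (sum-cong-≗ {s} (λ i → restrict (q i) (U i))) ⟩
    a * sum (λ i → ⟦ q i ⟧ * ∣ U i ∣ₘ)                         ≡⟨ *-distribˡ-sum {s} a (λ i → ⟦ q i ⟧ * ∣ U i ∣ₘ) ⟩
    sum (λ i → a * (⟦ q i ⟧ * ∣ U i ∣ₘ))                       ≡⟨ sum-cong-≗ {s} (λ i → *-swap a ⟦ q i ⟧ ∣ U i ∣ₘ) ⟩
    sum (λ i → ⟦ q i ⟧ * (a * ∣ U i ∣ₘ))                       ≤⟨ ∑-mono (λ i → *-monoʳ-≤ ⟦ q i ⟧ (few i)) ⟩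
    sum (λ i → ⟦ q i ⟧ * (b * (δ ∸ x)))                        ≡⟨ *-distribʳ-sum {s} (b * (δ ∸ x)) (⟦_⟧ ∘ q) ⟨
    ∣ q ∣ₘ * (b * (δ ∸ x))                                     ≡⟨ rotate ∣ q ∣ₘ b (δ ∸ x) ⟩
    (δ ∸ x) * (b * ∣ q ∣ₘ)                                     ≤⟨ *-monoˡ-≤ (b * ∣ q ∣ₘ) large ⟩
    ∣ P ∣ₘ * (b * ∣ q ∣ₘ)                                      ≡⟨ *-distribʳ-sum {n} (b * ∣ q ∣ₘ) (⟦_⟧ ∘ P) ⟩
    sum (λ v → ⟦ P v ⟧ * (b * ∣ q ∣ₘ))                         ∎)
    where
    open ≤-Reasoning
    rotate : ∀ x y z → x * (y * z) ≡ z * (y * x)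
    rotate = solve-∀
    restrict : ∀ c (V : Mask n) → sum (λ v → ⟦ c ∧ V v ⟧) ≡ ⟦ c ⟧ * ∣ V ∣ₘ
    restrict true  V = sym (+-identityʳ ∣ V ∣ₘ)
    restrict false V = ∑-zero {f = λ v → ⟦ false ∧ V v ⟧} λ _ → refl

  ∧-false : ∀ c {d} → c ∧ d ≡ false → c ≡ false ⊎ d ≡ false
  ∧-false false _  = inj₁ refl
  ∧-false true  eq = inj₂ eq

  start : ∀ {X} z → S z ≡ true → X z ≡ false →
          a * ∣ (λ i → true ∧ U i z) ∣ₘ ≤ b * ∣ (λ (_ : Fin s) → true) ∣ₘ → Partial 0 X
  start {X} z z∈S z∉X shrink = record
    { set      = singleton z
    ; missed   = λ i → true ∧ U i z
    ; tip      = z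
    ; disjoint = λ v v=z → subst (λ w → X w ≡ false) (sym (==-sound {u = v} v=z)) z∉X
    ; size     = ≤-reflexive (∣∣-singleton z)
    ; tip∈set  = ==-refl z
    ; tip∈S    = z∈S
    ; conn     = singleton-connected G z
    ; meets    = λ i ¬U → let (u , Au , u~z) = dominates i z z∈S ¬U in u , z , Au , ==-refl z , u~z
    ; decay    = geometric-step {a} {b} {0} shrink (≤-reflexive (cong (1 *_) (∑-const-1 s)))
    }

  module Extend {j X} (𝒫 : Partial j X) where
    open Partial 𝒫

    Y : Mask n
    Y v = X v ∨ set v

    extend : ∀ z → S z ∧ adj G tip z ≡ true → Y z ≡ false →
             a * ∣ (λ i → missed i ∧ U i z) ∣ₘ ≤ b * ∣ missed ∣ₘ → Partial (suc j) X
    extend z z∈ z∉Y shrink = record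
      { set      = insert z set
      ; missed   = λ i → missed i ∧ U i z
      ; tip      = z
      ; disjoint = λ v Iv → disjoint′ v (∨-elim {set v} Iv)
      ; size     = ≤-trans (∣insert∣ z set) (s≤s size)
      ; tip∈set  = ∨-introʳ {set z} (==-refl z)
      ; tip∈S    = ∧-elimˡ z∈
      ; conn     = insert-connected G conn tip∈set (∧-elimʳ {S z} z∈)
      ; meets    = λ i ¬m → meets′ i (∧-false (missed i) ¬m)
      ; decay    = geometric-step {a} {b} {suc j} shrink decay
      }
      where
      disjoint′ : ∀ v → set v ≡ true ⊎ singleton z v ≡ true → X v ≡ false
      disjoint′ v (inj₁ Bv)  = disjoint v Bv
      disjoint′ v (inj₂ v=z) = subst (λ w → X w ≡ false) (sym (==-sound {u = v} v=z)) (∨-falseˡ z∉Y)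
      meets′ : ∀ i → missed i ≡ false ⊎ U i z ≡ false →
               ∃₂ λ u v → A i u ≡ true × insert z set v ≡ true × adj G u v ≡ true
      meets′ i (inj₁ ¬m) = let (u , v , Au , Bv , u~v) = meets i ¬m in u , v , Au , ∨-introˡ Bv , u~v
      meets′ i (inj₂ ¬U) = let (u , Au , u~z) = dominates i z (∧-elimˡ z∈) ¬U in
                           u , z , Au , ∨-introʳ {set z} (==-refl z) , u~z

    extended : ∣ X ∣ₘ + suc j ≤ x → Partial (suc j) X
    extended budget =
      let (z , z∈ , shrink) = pick (λ v → (S v ∧ adj G tip v) ∧ not (Y v)) missed
                                (∣∣-difference (λ v → S v ∧ adj G tip v) Y (δ≤deg tip tip∈S) Y≤x)
      in extend z (∧-elimˡ z∈) (not-elim (∧-elimʳ {S z ∧ adj G tip z} z∈)) shrink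
      where
      Y≤x : ∣ Y ∣ₘ ≤ x
      Y≤x = ≤-trans (∣∣-∨ X set) (≤-trans (+-monoʳ-≤ ∣ X ∣ₘ size) budget)

  partial-connector : ∀ j X → ∣ X ∣ₘ + suc j ≤ x → Partial j X
  partial-connector zero    X budget =
    let (z , z∈ , shrink) = pick (λ v → S v ∧ not (X v)) (λ _ → true)
                              (∣∣-difference S X δ≤∣S∣ (≤-trans (m≤m+n ∣ X ∣ₘ 1) budget))
    in start z (∧-elimˡ z∈) (not-elim (∧-elimʳ {S z} z∈)) shrink
  partial-connector (suc j) X budget = Extend.extended (partial-connector j X budget′) budget′
    where budget′ = ≤-trans (+-monoʳ-≤ ∣ X ∣ₘ (n≤1+n (suc j))) budget

  -- If some set were still missed, `decay` would give a^(j+1) ≤ b^(j+1) s, against the hypothesis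
  -- on the powers.
  connector : ∀ j → b ^ suc j * s < a ^ suc j → ∀ X → ∣ X ∣ₘ + suc j ≤ x →
    ∃ λ B → (Connected G B × (∃ λ v → B v ≡ true) × (∀ i → ∃₂ λ u v → A i u ≡ true × B v ≡ true × adj G u v ≡ true))
            × Disjoint B X × ∣ B ∣ₘ ≤ suc j
  connector j small X budget =
    set , (conn , (tip , tip∈set) , λ i → meets i (mask-empty missed none i)) , disjoint , size
    where
    open Partial (partial-connector j X budget)
    none : ∣ missed ∣ₘ ≡ 0
    none = vanishes ∣ missed ∣ₘ decay
      where
      vanishes : ∀ m → a ^ suc j * m ≤ b ^ suc j * s → m ≡ 0
      vanishes zero    _ = refl
      vanishes (suc m) d = ⊥-elim (<⇒≱ small (≤-trans (m≤m*n (a ^ suc j) (suc m)) d))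

-- Assembling the minor from dominating sets and paths

module _ {n : ℕ} (G : Graph n) (S : Mask n) (δ : ℕ)
  (δ≤deg : ∀ z → S z ≡ true → δ ≤ ∣ (λ v → S v ∧ adj G z v) ∣ₘ)
  (δ≤∣S∣ : δ ≤ ∣ S ∣ₘ)
  (cut : ∀ U W → (∀ v → ⟦ S v ⟧ ≡ ⟦ U v ⟧ + ⟦ W v ⟧) → 3 * (∣ U ∣ₘ * ∣ W ∣ₘ) ≤ 8 * E G (⟦_⟧ ∘ U) (⟦_⟧ ∘ W))
  where

  module _ (s t a b : ℕ) {x y : ℕ} (0<x : 0 < x) (x-budget : s * suc (2 + a) ≤ x) (5x≤δ : 5 * x ≤ δ)
    (y-budget : x + t * suc b ≤ y) (y<δ : y < δ) (ratio : 16 * (∣ S ∣ₘ ∸ δ) ≤ 25 * (δ ∸ y))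
    (small : (4 ^ a) ^ suc b * s < (5 ^ a) ^ suc b)
    where

    Dominating : Mask n → Set
    Dominating A = Connected G A × (∃ λ v → A v ≡ true) × ∃ λ U →
      (∀ v → S v ≡ true → U v ≡ false → ∃ λ u → A u ≡ true × adj G u v ≡ true) × 5 ^ a * ∣ U ∣ₘ ≤ 4 ^ a * (δ ∸ y)

    dominating : ∀ Y → ∣ Y ∣ₘ + suc (2 + a) ≤ x → ∃ λ A → Dominating A × Disjoint A Y × ∣ A ∣ₘ ≤ suc (2 + a)
    dominating Y budget = set , (conn , member , undominated , dominates , few′) , disjoint , size
      where
      open Greedy G S δ δ≤deg δ≤∣S∣ cut
      open Dominator (dominator 0<x 5x≤δ (2 + a) Y budget)
      -- Two of the 2 + a growth steps pay for replacing |S| ∸ δ by δ ∸ y, through `ratio` and 16/25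
      -- = (4/5)²; the other `a` steps give the proportion (4/5)^a of the pool.
      few′ : 5 ^ a * ∣ undominated ∣ₘ ≤ 4 ^ a * (δ ∸ y)
      few′ = *-cancelˡ-≤ 25 (begin
        25 * (5 ^ a * ∣ undominated ∣ₘ)     ≡⟨ left (5 ^ a) ∣ undominated ∣ₘ ⟩
        5 ^ (2 + a) * ∣ undominated ∣ₘ      ≤⟨ decay ⟩
        4 ^ (2 + a) * (∣ S ∣ₘ ∸ δ)          ≡⟨ right (4 ^ a) (∣ S ∣ₘ ∸ δ) ⟩
        4 ^ a * (16 * (∣ S ∣ₘ ∸ δ))         ≤⟨ *-monoʳ-≤ (4 ^ a) ratio ⟩
        4 ^ a * (25 * (δ ∸ y))              ≡⟨ *-swap (4 ^ a) 25 (δ ∸ y) ⟩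
        25 * (4 ^ a * (δ ∸ y))              ∎)
        where
        open ≤-Reasoning
        left : ∀ p u → 25 * (p * u) ≡ 5 * (5 * p) * u
        left = solve-∀
        right : ∀ p r → 4 * (4 * p) * r ≡ p * (16 * r)
        right = solve-∀

    module _ (A : Fin s → Mask n) (Z : Mask n) (QA : ∀ i → Dominating (A i))
      (A-unique : ∀ i j v → A i v ≡ true → A j v ≡ true → i ≡ j)
      (A⊆Z : ∀ i v → A i v ≡ true → Z v ≡ true) (Z≤x : ∣ Z ∣ₘ ≤ x)
      where

      Connecting : Mask n → Set
      Connecting B = Connected G B × (∃ λ v → B v ≡ true) ×
        (∀ i → ∃₂ λ u v → A i u ≡ true × B v ≡ true × adj G u v ≡ true)

      connecting : ∀ Y → ∣ Y ∣ₘ + suc b ≤ y → ∃ λ B → Connecting B × Disjoint B Y × ∣ B ∣ₘ ≤ suc b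
      connecting = connector b small
        where
        open Connector G S δ y δ≤deg δ≤∣S∣ y<δ (5 ^ a) (4 ^ a) A (λ i → proj₁ (proj₂ (proj₂ (QA i))))
               (λ i → proj₁ (proj₂ (proj₂ (proj₂ (QA i))))) (λ i → proj₂ (proj₂ (proj₂ (proj₂ (QA i)))))

      assemble : (B : Fin t → Mask n) → (∀ j → Connecting (B j)) → (∀ j → Disjoint (B j) Z) →
        (∀ i j v → B i v ≡ true → B j v ≡ true → i ≡ j) → HasKstMinor s t G
      assemble B QB B∩Z B-unique =
        minor-from-sets G M unique nonempty connected (λ i j → proj₂ (proj₂ (QB j)) i)
        where
        M : Fin s ⊎ Fin t → Mask n
        M (inj₁ i) = A i
        M (inj₂ j) = B j
        unique : ∀ b b′ v → M b v ≡ true → M b′ v ≡ true → b ≡ b′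
        unique (inj₁ i) (inj₁ j) v p q = cong inj₁ (A-unique i j v p q)
        unique (inj₁ i) (inj₂ j) v p q = ⊥-elim (true≢false (A⊆Z i v p) (B∩Z j v q))
        unique (inj₂ i) (inj₁ j) v p q = ⊥-elim (true≢false (A⊆Z j v q) (B∩Z i v p))
        unique (inj₂ i) (inj₂ j) v p q = cong inj₂ (B-unique i j v p q)
        nonempty : ∀ b → ∃ λ v → M b v ≡ true
        nonempty (inj₁ i) = proj₁ (proj₂ (QA i))
        nonempty (inj₂ j) = proj₁ (proj₂ (QB j))
        connected : ∀ b → Connected G (M b)
        connected (inj₁ i) = proj₁ (QA i)
        connected (inj₂ j) = proj₁ (QB j)

      finish : HasKstMinor s t G
      finish =
        -- Starting from `Z` keeps the paths off all the dominating sets.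
        let (B , _ , QB , B∩Z , B-unique , _) =
              disjoint-family Connecting (suc b) y t Z (≤-trans (+-monoˡ-≤ (t * suc b) Z≤x) y-budget) connecting
        in assemble B QB B∩Z B-unique

    greedy-minor : HasKstMinor s t G
    greedy-minor =
      let (A , Z , QA , _ , A-unique , _ , A⊆Z , Z≤) =
            disjoint-family Dominating (suc (2 + a)) x s (λ _ → false) start≤x dominating
      in finish A Z QA A-unique A⊆Z (≤-trans Z≤ start≤x)
      where
      start≤x : ∣ (λ (_ : Fin n) → false) ∣ₘ + s * suc (2 + a) ≤ x
      start≤x = ≤-trans (≤-reflexive (cong (_+ s * suc (2 + a)) (∑-zero {n} {λ _ → 0} λ _ → refl))) x-budget

-- Minimal dense vertex sets

edges : ∀ {n} → Graph n → Mask n → ℕ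
edges G S = E G (⟦_⟧ ∘ S) (⟦_⟧ ∘ S)

module _ {n : ℕ} (G : Graph n) (K : ℕ) where

  -- The quadratic term makes the two sides u, w of a cut miss quota (u + w) by 6uw, which forces
  -- many edges across it; the linear term keeps dense sets larger than 2K/5.
  quota : ℕ → ℕ
  quota m = 3 * (m * m) + 2 * K * m

  Dense : Mask n → Set
  Dense S = quota ∣ S ∣ₘ ≤ 8 * edges G S

  -- With ≤ in its conclusion, `minimal` also covers the empty mask, where both sides are 0;
  -- `degree` meets this case if `S` is a single vertex.
  module MinimalDense (S : Mask n) (0<S : 0 < ∣ S ∣ₘ) (dense : Dense S)
    (minimal : ∀ Z → ∣ Z ∣ₘ < ∣ S ∣ₘ → 8 * edges G Z ≤ quota ∣ Z ∣ₘ) where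

    module _ (U W : Mask n) (S=U+W : ∀ v → ⟦ S v ⟧ ≡ ⟦ U v ⟧ + ⟦ W v ⟧) where
      cross : ℕ
      cross = E G (⟦_⟧ ∘ U) (⟦_⟧ ∘ W)

      ∣S∣≡ : ∣ S ∣ₘ ≡ ∣ U ∣ₘ + ∣ W ∣ₘ
      ∣S∣≡ = trans (sum-cong-≗ {n} S=U+W) (∑-distrib-+ (⟦_⟧ ∘ U) (⟦_⟧ ∘ W))

      quota≤ : quota (∣ U ∣ₘ + ∣ W ∣ₘ) ≤ 8 * (edges G U + 2 * cross + edges G W)
      quota≤ = subst₂ _≤_ (cong quota ∣S∣≡) (cong (8 *_) (E-square G (⟦_⟧ ∘ U) (⟦_⟧ ∘ W) S=U+W)) dense

    -- If both sides are nonempty, each is smaller than `S` and within its quota by `minimal`. The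
    -- missing 6uw must then come from the cross edges, which the degree sum of `S` counts twice.
    cut : ∀ U W → (∀ v → ⟦ S v ⟧ ≡ ⟦ U v ⟧ + ⟦ W v ⟧) → 3 * (∣ U ∣ₘ * ∣ W ∣ₘ) ≤ 8 * E G (⟦_⟧ ∘ U) (⟦_⟧ ∘ W)
    cut U W S=U+W with ∣ U ∣ₘ ℕ.≟ 0 | ∣ W ∣ₘ ℕ.≟ 0
    ... | yes u≡0 | _       rewrite u≡0 = z≤n
    ... | no _    | yes w≡0 rewrite w≡0 | *-zeroʳ ∣ U ∣ₘ = z≤n
    ... | no u≢0  | no w≢0  = *-cancelˡ-≤ 2 (by-adding 0
        (+-mono-≤ (quota≤ U W S=U+W) (+-mono-≤ (minimal U u<σ) (minimal W w<σ)))
        (lemma ∣ U ∣ₘ ∣ W ∣ₘ K (edges G U) (cross U W S=U+W) (edges G W)))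
      where
      u<σ : ∣ U ∣ₘ < ∣ S ∣ₘ
      u<σ = ≤-trans (m<m+n ∣ U ∣ₘ (n≢0⇒n>0 w≢0)) (≤-reflexive (sym (∣S∣≡ U W S=U+W)))
      w<σ : ∣ W ∣ₘ < ∣ S ∣ₘ
      w<σ = ≤-trans (m<n+m ∣ W ∣ₘ (n≢0⇒n>0 u≢0)) (≤-reflexive (sym (∣S∣≡ U W S=U+W)))
      lemma : ∀ u w k eᵤ e eʷ →
        2 * (8 * e) + (3 * ((u + w) * (u + w)) + 2 * k * (u + w) + (8 * eᵤ + 8 * eʷ)) ≡
        2 * (3 * (u * w)) + (8 * (eᵤ + 2 * e + eʷ) + (3 * (u * u) + 2 * k * u + (3 * (w * w) + 2 * k * w))) + 0
      lemma = solve-∀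

    -- A single vertex spans no edges, so 0 replaces the bound quota 1 = 3 + 2K that `cut` would use
    -- for that side. This is where the term 2K is gained.
    degree : ∀ z → S z ≡ true → 6 * ∣ S ∣ₘ + 2 * K ≤ 16 * ∣ (λ v → S v ∧ adj G z v) ∣ₘ + 3
    degree z Sz = begin
      6 * ∣ S ∣ₘ + 2 * K                  ≡⟨ cong (λ m → 6 * m + 2 * K) ∣S∣≡1+W ⟩
      6 * (1 + ∣ W ∣ₘ) + 2 * K            ≤⟨ by-adding 0 (+-mono-≤ quota≤′ (minimal W W<S)) (lemma ∣ W ∣ₘ K e (edges G W)) ⟩
      16 * e + 3                          ≤⟨ +-monoˡ-≤ 3 (*-monoʳ-≤ 16 e≤deg) ⟩
      16 * ∣ (λ v → S v ∧ adj G z v) ∣ₘ + 3 ∎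
      where
      open ≤-Reasoning
      U W : Mask n
      U = singleton z
      W v = S v ∧ not (singleton z v)
      S=U+W : ∀ v → ⟦ S v ⟧ ≡ ⟦ U v ⟧ + ⟦ W v ⟧
      S=U+W v with v Fin.≟ z
      ... | yes refl rewrite Sz = refl
      ... | no _ with S v
      ...   | true  = refl
      ...   | false = refl
      e : ℕ
      e = E G (⟦_⟧ ∘ U) (⟦_⟧ ∘ W)
      ∣S∣≡1+W : ∣ S ∣ₘ ≡ 1 + ∣ W ∣ₘ
      ∣S∣≡1+W = trans (∣S∣≡ U W S=U+W) (cong (_+ ∣ W ∣ₘ) (∣∣-singleton z))
      W<S : ∣ W ∣ₘ < ∣ S ∣ₘ
      W<S = ≤-reflexive (sym ∣S∣≡1+W)
      from-z : ∀ V → E G (⟦_⟧ ∘ U) (⟦_⟧ ∘ V) ≡ cover G V z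
      from-z V = ∑-δ z (cover G V)
      loop : edges G U ≡ 0
      loop = trans (from-z U) (trans (sum-cong-≗ {n} λ v → *-comm ⟦ adj G z v ⟧ ⟦ v == z ⟧)
             (trans (∑-δ z (λ v → ⟦ adj G z v ⟧)) (cong ⟦_⟧ (irrefl G z))))
      quota≤′ : quota (1 + ∣ W ∣ₘ) ≤ 8 * (0 + 2 * e + edges G W)
      quota≤′ = subst₂ _≤_ (cong (λ m → quota (m + ∣ W ∣ₘ)) (∣∣-singleton z))
                           (cong (λ m → 8 * (m + 2 * e + edges G W)) loop) (quota≤ U W S=U+W)
      e≤deg : e ≤ ∣ (λ v → S v ∧ adj G z v) ∣ₘ
      e≤deg = ≤-trans (≤-reflexive (from-z W)) (∑-mono λ v → pointwise (adj G z v) (S v) (not (singleton z v)))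
        where
        pointwise : ∀ a s t → ⟦ a ⟧ * ⟦ s ∧ t ⟧ ≤ ⟦ s ∧ a ⟧
        pointwise false s     t     = z≤n
        pointwise true  false t     = z≤n
        pointwise true  true  false = z≤n
        pointwise true  true  true  = ≤-refl
      lemma : ∀ w k e eʷ → 16 * e + 3 + (3 * ((1 + w) * (1 + w)) + 2 * k * (1 + w) + 8 * eʷ) ≡
              6 * (1 + w) + 2 * k + (8 * (0 + 2 * e + eʷ) + (3 * (w * w) + 2 * k * w)) + 0
      lemma = solve-∀

    -- The degree sum is at most m² for m = |S|, so 3m² + 2Km ≤ 8m²; divide by m.
    large : 2 * K ≤ 5 * ∣ S ∣ₘ
    large = *-cancelʳ-≤ (2 * K) (5 * ∣ S ∣ₘ) ∣ S ∣ₘ ⦃ ℕ.>-nonZero 0<S ⦄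
      (by-adding 0 (≤-trans dense (*-monoʳ-≤ 8 (E≤product G (⟦_⟧ ∘ S) (⟦_⟧ ∘ S)))) (lemma ∣ S ∣ₘ K))
      where
      lemma : ∀ m k → 5 * m * m + (3 * (m * m) + 2 * k * m) ≡ 2 * k * m + 8 * (m * m) + 0
      lemma = solve-∀

  module _ (s t a b : ℕ) {x y : ℕ} (60≤K : 60 ≤ K) (0<x : 0 < x)
    (x-budget : s * suc (2 + a) ≤ x) (y-budget : x + t * suc b ≤ y)
    (20x≤K+1 : 20 * x ≤ K + 1) (80y≤9K+9 : 80 * y ≤ 9 * (K + 1))
    (small : (4 ^ a) ^ suc b * s < (5 ^ a) ^ suc b)
    where

    minimal-dense⇒minor : ∀ S → 0 < ∣ S ∣ₘ → ∣ S ∣ₘ ≤ 2 * K → Dense S →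
      (∀ Z → ∣ Z ∣ₘ < ∣ S ∣ₘ → 8 * edges G Z ≤ quota ∣ Z ∣ₘ) → HasKstMinor s t G
    minimal-dense⇒minor S 0<S S≤2K dense minimal =
      greedy-minor G S δ δ≤deg δ≤S cut s t a b 0<x x-budget 5x≤δ y-budget y<δ ratio small
      where
      open MinimalDense S 0<S dense minimal
      σ N δ : ℕ
      σ = ∣ S ∣ₘ
      N = 6 * σ + 2 * K ∸ 3
      -- The minimum degree guaranteed by `degree`. Rounding down loses at most 15, which together
      -- with the 3 makes the 18 below.
      δ = N ℕ./ 16
      16δ≤N : 16 * δ ≤ N
      16δ≤N = ≤-trans (≤-reflexive (*-comm 16 δ)) (m/n*n≤m N 16)
      N≤16δ+18 : 6 * σ + 2 * K ≤ 16 * δ + 18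
      N≤16δ+18 = begin
        6 * σ + 2 * K           ≤⟨ m≤n+m∸n (6 * σ + 2 * K) 3 ⟩
        3 + N                   ≡⟨ cong (3 ℕ.+_) (m≡m%n+[m/n]*n N 16) ⟩
        3 + (N ℕ.% 16 + δ * 16)   ≤⟨ +-monoʳ-≤ 3 (+-monoˡ-≤ (δ * 16) (≤-pred (m%n<n N 16))) ⟩
        3 + (15 + δ * 16)       ≡⟨ lemma δ ⟩
        16 * δ + 18             ∎
        where
        open ≤-Reasoning
        lemma : ∀ d → 3 + (15 + d * 16) ≡ 16 * d + 18
        lemma = solve-∀
      δ≤deg : ∀ z → S z ≡ true → δ ≤ ∣ (λ v → S v ∧ adj G z v) ∣ₘ
      δ≤deg z Sz = *-cancelˡ-≤ 16 (≤-trans 16δ≤N (m≤n+o⇒m∸n≤o (6 * σ + 2 * K) 3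
        (≤-trans (degree z Sz) (≤-reflexive (+-comm _ 3)))))
      δ≤S : δ ≤ σ
      δ≤S = let (z , Sz) = mask-member S 0<S in
        ≤-trans (δ≤deg z Sz) (∣∣-mono {M = λ v → S v ∧ adj G z v} {S} λ v → ∧-elimˡ)
      -- By `large`, 6σ + 2K ≥ 22K/5, so δ is about 11K/40 at least. This exceeds both 5x ≤ (K +
      -- 1)/4 and y ≤ 9(K + 1)/80, with K ≥ 60 absorbing the rounding.
      5x≤δ : 5 * x ≤ δ
      5x≤δ = *-cancelˡ-≤ 80 (by-adding 10
        (+-mono-≤ (*-monoʳ-≤ 20 20x≤K+1) (+-mono-≤ (*-monoʳ-≤ 5 N≤16δ+18) (+-mono-≤ (*-monoʳ-≤ 6 large) (*-monoʳ-≤ 2 60≤K))))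
        (lemma x δ σ K))
        where
        lemma : ∀ x d m k → 80 * d + (20 * (20 * x) + (5 * (6 * m + 2 * k) + (6 * (2 * k) + 2 * 60))) ≡
          80 * (5 * x) + (20 * (k + 1) + (5 * (16 * d + 18) + (6 * (5 * m) + 2 * k))) + 10
        lemma = solve-∀
      y<δ : y < δ
      y<δ = *-cancelˡ-≤ 80 (by-adding 601
        (+-mono-≤ 80y≤9K+9 (+-mono-≤ (*-monoʳ-≤ 5 N≤16δ+18) (+-mono-≤ (*-monoʳ-≤ 6 large) (*-monoʳ-≤ 13 60≤K))))
        (lemma y δ σ K))
        where
        lemma : ∀ y d m k → 80 * d + (80 * y + (5 * (6 * m + 2 * k) + (6 * (2 * k) + 13 * 60))) ≡
          80 * (1 + y) + (9 * (k + 1) + (5 * (16 * d + 18) + (6 * (5 * m) + 13 * k))) + 601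
        lemma = solve-∀
      -- Equivalently 16σ + 25y ≤ 41δ. Up to constants 16 · 41δ ≥ 246σ + 82K, while 10σ + 400y ≤ 20K
      -- + 45K by σ ≤ 2K and the bound on y; the remaining 17K covers the constants.
      ratio : 16 * (σ ∸ δ) ≤ 25 * (δ ∸ y)
      ratio = *-cancelˡ-≤ 16 (by-adding 237
        (+-mono-≤ (*-monoʳ-≤ 41 N≤16δ+18) (+-mono-≤ (*-monoʳ-≤ 10 S≤2K) (+-mono-≤ (*-monoʳ-≤ 5 80y≤9K+9) (*-monoʳ-≤ 17 60≤K))))
        (subst₂ (λ m d → 16 * (25 * q) + (41 * (6 * m + 2 * K) + (10 * m + (5 * (80 * y) + 17 * 60))) ≡
                         16 * (16 * p) + (41 * (16 * d + 18) + (10 * (2 * K) + (5 * (9 * (K + 1)) + 17 * K))) + 237)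
          (trans (cong (_+ p) (m+[n∸m]≡n (<⇒≤ y<δ))) (m+[n∸m]≡n δ≤S)) (m+[n∸m]≡n (<⇒≤ y<δ)) (lemma y q p K)))
        where
        p q : ℕ
        p = σ ∸ δ
        q = δ ∸ y
        lemma : ∀ y q p k →
          16 * (25 * q) + (41 * (6 * (y + q + p) + 2 * k) + (10 * (y + q + p) + (5 * (80 * y) + 17 * 60))) ≡
          16 * (16 * p) + (41 * (16 * (y + q) + 18) + (10 * (2 * k) + (5 * (9 * (k + 1)) + 17 * k))) + 237
        lemma = solve-∀

    -- Induction on a size bound takes the place of choosing a minimal set: smaller dense masks are
    -- excluded by the induction hypothesis, so `S` is itself minimal and yields the minor.
    no-dense-mask : ¬ HasKstMinor s t G → ∀ m S → ∣ S ∣ₘ ≤ m → 0 < ∣ S ∣ₘ → ∣ S ∣ₘ ≤ 2 * K → ¬ Dense S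
    no-dense-mask ¬minor zero    S S≤0 0<S _    _     = <⇒≱ 0<S S≤0
    no-dense-mask ¬minor (suc m) S S≤m 0<S S≤2K dense =
      ¬minor (minimal-dense⇒minor S 0<S S≤2K dense minimal)
      where
      minimal : ∀ Z → ∣ Z ∣ₘ < ∣ S ∣ₘ → 8 * edges G Z ≤ quota ∣ Z ∣ₘ
      minimal Z Z<S with ∣ Z ∣ₘ ℕ.≟ 0
      ... | yes ∣Z∣≡0 = ≤-trans (*-monoʳ-≤ 8 (E≤product G (⟦_⟧ ∘ Z) (⟦_⟧ ∘ Z)))
                         (subst (λ k → 8 * (k * k) ≤ quota k) (sym ∣Z∣≡0) z≤n)
      ... | no ∣Z∣≢0 = <⇒≤ (≰⇒> (no-dense-mask ¬minor m Z (≤-pred (≤-trans Z<S S≤m))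
                         (n≢0⇒n>0 ∣Z∣≢0) (≤-trans (<⇒≤ Z<S) S≤2K)))

-- Deleting and contracting edges

module _ {n} (G : Graph n) where

  deg : Fin n → ℕ
  deg v = ∣ adj G v ∣ₘ

  common : Fin n → Fin n → ℕ
  common u v = ∣ (λ w → adj G u w ∧ adj G v w) ∣ₘ

  degreeSum : ℕ
  degreeSum = sum deg

  -- Serves as the number of vertices: every graph of the reduction lives on the same `Fin n`, and a
  -- vertex that has been contracted away is isolated.
  nonIsolated : ℕ
  nonIsolated = sum λ v → 1 ⊓ deg v

  adjacent⇒≢ : ∀ {u v} → adj G u v ≡ true → u ≢ v
  adjacent⇒≢ {u} u~v refl = true≢false u~v (irrefl G u)

  adjacent⇒0<deg : ∀ {u v} → adj G u v ≡ true → 0 < deg u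
  adjacent⇒0<deg {u} u~v = member⇒positive (adj G u) u~v

1⊓-mono : ∀ {c d} → (0 < c → 0 < d) → 1 ⊓ c ≤ 1 ⊓ d
1⊓-mono {zero}  _ = z≤n
1⊓-mono {suc c} f = ≤-reflexive (sym (m≤n⇒m⊓n≡m (f (s≤s z≤n))))

path-mono : ∀ {n} {G G′ : Graph n} → (∀ {u v} → adj G′ u v ≡ true → adj G u v ≡ true) →
            ∀ {P : Fin n → Set} {u v} → PathIn G′ P u v → PathIn G P u v
path-mono sub (here p)     = here p
path-mono sub (step p a r) = step p (sub a) (path-mono sub r)

minor-mono : ∀ {s t n} {G G′ : Graph n} → (∀ {u v} → adj G′ u v ≡ true → adj G u v ≡ true) →
             HasKstMinor s t G′ → HasKstMinor s t G
minor-mono sub M = record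
  { branch    = branch
  ; nonempty  = nonempty
  ; connected = λ b u v pu pv → path-mono sub (connected b u v pu pv)
  ; adjacent  = λ a c → let (u , v , pu , pv , u~v) = adjacent a c in u , v , pu , pv , sub u~v
  }
  where open KstMinorModel M

∑∑-δδ : ∀ {n} (x y : Fin n) → sum (λ u → sum λ v → ⟦ u == x ⟧ * ⟦ v == y ⟧) ≡ 1
∑∑-δδ {n} x y = begin
  sum (λ u → sum λ v → ⟦ u == x ⟧ * ⟦ v == y ⟧)   ≡⟨ sum-cong-≗ {n} (λ u → *-distribˡ-sum {n} ⟦ u == x ⟧ (λ v → ⟦ v == y ⟧)) ⟨
  sum (λ u → ⟦ u == x ⟧ * ∣ singleton y ∣ₘ)       ≡⟨ ∑-δ x (λ _ → ∣ singleton y ∣ₘ) ⟩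
  ∣ singleton y ∣ₘ                                ≡⟨ ∣∣-singleton y ⟩
  1                                               ∎
  where open ≡-Reasoning

∑∑-distrib-+ : ∀ {m n} (f g : Fin m → Fin n → ℕ) →
  sum (λ u → sum λ v → f u v + g u v) ≡ sum (λ u → sum (f u)) + sum (λ u → sum (g u))
∑∑-distrib-+ {m} f g = trans (sum-cong-≗ {m} λ u → ∑-distrib-+ (f u) (g u)) (∑-distrib-+ (sum ∘ f) (sum ∘ g))

module Delete {n} (G : Graph n) (x y : Fin n) (x~y : adj G x y ≡ true) where

  removed : Fin n → Fin n → Bool
  removed u v = (u == x ∧ v == y) ∨ (u == y ∧ v == x)

  removed-symm : ∀ u v → removed u v ≡ removed v u
  removed-symm u v = trans (Bool.∨-comm (u == x ∧ v == y) (u == y ∧ v == x))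
    (cong₂ _∨_ (Bool.∧-comm (u == y) (v == x)) (Bool.∧-comm (u == x) (v == y)))

  delete : Graph n
  delete = record
    { adj    = λ u v → adj G u v ∧ not (removed u v)
    ; symm   = λ u v → cong₂ (λ a r → a ∧ not r) (symm G u v) (removed-symm u v)
    ; irrefl = λ v → cong (_∧ not (removed v v)) (irrefl G v)
    }

  delete-minor : ∀ {s t} → HasKstMinor s t delete → HasKstMinor s t G
  delete-minor = minor-mono ∧-elimˡ

  delete-nonIsolated : nonIsolated delete ≤ nonIsolated G
  delete-nonIsolated = ∑-mono λ v → 1⊓-mono λ 0<deg′ →
    let (w , v~w) = mask-member (adj delete v) 0<deg′ in member⇒positive (adj G v) (∧-elimˡ v~w)

  delete-degreeSum : degreeSum G ≤ degreeSum delete + 2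
  delete-degreeSum = begin
    degreeSum G
      ≤⟨ ∑-mono (λ u → ∑-mono λ v → pointwise (adj G u v) (u == x) (v == y) (u == y) (v == x)) ⟩
    sum (λ u → sum λ v → ⟦ adj delete u v ⟧ + (⟦ u == x ⟧ * ⟦ v == y ⟧ + ⟦ u == y ⟧ * ⟦ v == x ⟧))
      ≡⟨ ∑∑-distrib-+ (λ u v → ⟦ adj delete u v ⟧) (λ u v → ⟦ u == x ⟧ * ⟦ v == y ⟧ + ⟦ u == y ⟧ * ⟦ v == x ⟧) ⟩
    degreeSum delete + sum (λ u → sum λ v → ⟦ u == x ⟧ * ⟦ v == y ⟧ + ⟦ u == y ⟧ * ⟦ v == x ⟧)
      ≡⟨ cong (degreeSum delete ℕ.+_) (trans (∑∑-distrib-+ (λ u v → ⟦ u == x ⟧ * ⟦ v == y ⟧) (λ u v → ⟦ u == y ⟧ * ⟦ v == x ⟧))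
                                    (cong₂ _+_ (∑∑-δδ x y) (∑∑-δδ y x))) ⟩
    degreeSum delete + 2 ∎
    where
    open ≤-Reasoning
    pointwise : ∀ a b c d e → ⟦ a ⟧ ≤ ⟦ a ∧ not ((b ∧ c) ∨ (d ∧ e)) ⟧ + (⟦ b ⟧ * ⟦ c ⟧ + ⟦ d ⟧ * ⟦ e ⟧)
    pointwise false b     c     d     e     = z≤n
    pointwise true  true  true  d     e     = s≤s z≤n
    pointwise true  true  false true  true  = ≤-refl
    pointwise true  true  false true  false = s≤s z≤n
    pointwise true  true  false false e     = s≤s z≤n
    pointwise true  false c     true  true  = ≤-refl
    pointwise true  false c     true  false = s≤s z≤n
    pointwise true  false c     false e     = s≤s z≤n

  delete-< : degreeSum delete < degreeSum G
  delete-< = ∑-strict (λ u → ∣∣-mono {M = adj delete u} {adj G u} λ v → ∧-elimˡ) x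
    (∑-strict (λ v → pointwise (adj G x v) (removed x v)) y strict)
    where
    pointwise : ∀ a r → ⟦ a ∧ not r ⟧ ≤ ⟦ a ⟧
    pointwise false r     = z≤n
    pointwise true  false = ≤-refl
    pointwise true  true  = z≤n
    strict : ⟦ adj delete x y ⟧ < ⟦ adj G x y ⟧
    strict rewrite x~y | ==-refl x | ==-refl y = s≤s z≤n

module Contract {n} (G : Graph n) (x y : Fin n) (x~y : adj G x y ≡ true) where

  link : Fin n → Fin n → Bool
  link u v = adj G u v ∨ ((u == x ∧ adj G y v) ∨ (v == x ∧ adj G y u))

  keep : Fin n → Fin n → Bool
  keep u v = not (u == y) ∧ (not (v == y) ∧ not (u == v))

  link-symm : ∀ u v → link u v ≡ link v u
  link-symm u v = cong₂ _∨_ (symm G u v) (Bool.∨-comm (u == x ∧ adj G y v) (v == x ∧ adj G y u))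

  ==-symm : ∀ (u v : Fin n) → u == v ≡ v == u
  ==-symm u v with u Fin.≟ v
  ... | yes refl = sym (==-refl u)
  ... | no u≢v   = sym (==-≢ (u≢v ∘ sym))

  keep-symm : ∀ u v → keep u v ≡ keep v u
  keep-symm u v rewrite ==-symm u v = swap (not (u == y)) (not (v == y)) (not (v == u))
    where
    swap : ∀ a b c → a ∧ (b ∧ c) ≡ b ∧ (a ∧ c)
    swap false false c = refl
    swap false true  c = refl
    swap true  false c = refl
    swap true  true  c = refl

  keep-irrefl : ∀ v → keep v v ≡ false
  keep-irrefl v rewrite ==-refl v with v == y
  ... | true  = refl
  ... | false = refl

  -- The contraction lives on the same vertex set: x takes over the neighbours of y, and y
  -- becomes isolated.
  contract : Graph n
  contract = record
    { adj    = λ u v → keep u v ∧ link u v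
    ; symm   = λ u v → cong₂ _∧_ (keep-symm u v) (link-symm u v)
    ; irrefl = λ v → cong (_∧ link v v) (keep-irrefl v)
    }

  x≢y : x ≢ y
  x≢y = adjacent⇒≢ G x~y

  data Link (u v : Fin n) : Set where
    direct  : adj G u v ≡ true → Link u v
    via-xˡ  : u ≡ x → adj G y v ≡ true → Link u v
    via-xʳ  : v ≡ x → adj G y u ≡ true → Link u v

  contract-adj : ∀ {u v} → adj contract u v ≡ true → u ≢ y × v ≢ y × Link u v
  contract-adj {u} {v} eq = ≢-from (∧-elimˡ k) , ≢-from (∧-elimˡ (∧-elimʳ {not (u == y)} k)) , linked (∨-elim (∧-elimʳ {keep u v} eq))
    where
    k : keep u v ≡ true
    k = ∧-elimˡ eq
    ≢-from : ∀ {w} → not (w == y) ≡ true → w ≢ y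
    ≢-from p refl = true≢false (==-refl y) (not-elim p)
    linked : adj G u v ≡ true ⊎ (u == x ∧ adj G y v) ∨ (v == x ∧ adj G y u) ≡ true → Link u v
    linked (inj₁ a) = direct a
    linked (inj₂ p) with ∨-elim {u == x ∧ adj G y v} p
    ... | inj₁ q = via-xˡ (==-sound {u = u} (∧-elimˡ q)) (∧-elimʳ {u == x} q)
    ... | inj₂ q = via-xʳ (==-sound {u = v} (∧-elimˡ q)) (∧-elimʳ {v == x} q)

  -- `y` drops out, and no isolated vertex gains an edge: new edges join `x` to neighbours of `y`,
  -- all of positive degree before.
  contract-nonIsolated : nonIsolated contract < nonIsolated G
  contract-nonIsolated = ∑-strict (λ v → 1⊓-mono (still v)) y strict
    where
    still : ∀ v → 0 < deg contract v → 0 < deg G v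
    still v 0<deg′ with mask-member (adj contract v) 0<deg′
    ... | w , v~w with proj₂ (proj₂ (contract-adj v~w))
    ...   | direct a      = adjacent⇒0<deg G a
    ...   | via-xˡ refl _ = adjacent⇒0<deg G x~y
    ...   | via-xʳ _ a    = adjacent⇒0<deg G (trans (symm G v y) a)
    isolated : deg contract y ≡ 0
    isolated = ∑-zero {f = λ v → ⟦ adj contract y v ⟧} zero-term
      where
      zero-term : ∀ v → ⟦ adj contract y v ⟧ ≡ 0
      zero-term v rewrite ==-refl y = refl
    strict : 1 ⊓ deg contract y < 1 ⊓ deg G y
    strict = subst₂ _<_ (cong (1 ⊓_) (sym isolated))
      (sym (m≤n⇒m⊓n≡m (adjacent⇒0<deg G (trans (symm G y x) x~y)))) (s≤s z≤n)

  fresh : Fin n → Bool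
  fresh v = adj G y v ∧ (not (adj G x v) ∧ not (v == x))

  deg-y : deg G y ≤ ∣ fresh ∣ₘ + (common G x y + 1)
  deg-y = begin
    deg G y
      ≤⟨ ∑-mono (λ v → pointwise (adj G y v) (adj G x v) (v == x)) ⟩
    sum (λ v → ⟦ fresh v ⟧ + (⟦ adj G x v ∧ adj G y v ⟧ + ⟦ v == x ⟧))
      ≡⟨ ∑-distrib-+ (⟦_⟧ ∘ fresh) (λ v → ⟦ adj G x v ∧ adj G y v ⟧ + ⟦ v == x ⟧) ⟩
    ∣ fresh ∣ₘ + sum (λ v → ⟦ adj G x v ∧ adj G y v ⟧ + ⟦ v == x ⟧)
      ≡⟨ cong (∣ fresh ∣ₘ ℕ.+_) (trans (∑-distrib-+ (λ v → ⟦ adj G x v ∧ adj G y v ⟧) (λ v → ⟦ v == x ⟧))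
                                     (cong (common G x y ℕ.+_) (∣∣-singleton x))) ⟩
    ∣ fresh ∣ₘ + (common G x y + 1) ∎
    where
    open ≤-Reasoning
    pointwise : ∀ a b c → ⟦ a ⟧ ≤ ⟦ a ∧ (not b ∧ not c) ⟧ + (⟦ b ∧ a ⟧ + ⟦ c ⟧)
    pointwise false b     c     = z≤n
    pointwise true  true  c     = s≤s z≤n
    pointwise true  false true  = s≤s z≤n
    pointwise true  false false = s≤s z≤n

  row : ∀ (z : Fin n) (f : Fin n → ℕ) → sum (λ u → sum λ v → ⟦ u == z ⟧ * f v) ≡ sum f
  row z f = trans (sum-cong-≗ {n} λ u → sym (*-distribˡ-sum {n} ⟦ u == z ⟧ f)) (∑-δ z (λ _ → sum f))

  column : ∀ (z : Fin n) (f : Fin n → ℕ) → sum (λ u → sum λ v → ⟦ v == z ⟧ * f u) ≡ sum f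
  column z f = trans (∑-comm {n} {n} (λ u v → ⟦ v == z ⟧ * f u)) (row z f)

  cross-sum : ∀ (H : Graph n) z (M : Mask n) →
    sum (λ u → sum λ v → ⟦ adj H u v ⟧ + (⟦ u == z ⟧ * ⟦ M v ⟧ + ⟦ v == z ⟧ * ⟦ M u ⟧)) ≡ degreeSum H + (∣ M ∣ₘ + ∣ M ∣ₘ)
  cross-sum H z M = trans (∑∑-distrib-+ (λ u v → ⟦ adj H u v ⟧) (λ u v → ⟦ u == z ⟧ * ⟦ M v ⟧ + ⟦ v == z ⟧ * ⟦ M u ⟧))
    (cong (degreeSum H ℕ.+_) (trans (∑∑-distrib-+ (λ u v → ⟦ u == z ⟧ * ⟦ M v ⟧) (λ u v → ⟦ v == z ⟧ * ⟦ M u ⟧))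
                                  (cong₂ _+_ (row z (⟦_⟧ ∘ M)) (column z (⟦_⟧ ∘ M)))))

  -- The edges gained at `x` stand on the left and those lost at `y` on the right. Summed over
  -- ordered pairs this reads e + 2 |fresh| ≤ e′ + 2 deg y.
  pointwise : ∀ u v → ⟦ adj G u v ⟧ + (⟦ u == x ⟧ * ⟦ fresh v ⟧ + ⟦ v == x ⟧ * ⟦ fresh u ⟧)
                    ≤ ⟦ adj contract u v ⟧ + (⟦ u == y ⟧ * ⟦ adj G y v ⟧ + ⟦ v == y ⟧ * ⟦ adj G y u ⟧)
  pointwise u v with u Fin.≟ y | v Fin.≟ y
  ... | yes refl | yes refl rewrite irrefl G y | ==-≢ (x≢y ∘ sym) = z≤n
  ... | yes refl | no _ rewrite irrefl G y | ==-≢ (x≢y ∘ sym) | *-zeroʳ ⟦ v == x ⟧ =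
        ≤-reflexive (trans (+-identityʳ ⟦ adj G y v ⟧) (sym (trans (+-identityʳ _) (+-identityʳ _))))
  ... | no _ | yes refl rewrite irrefl G y | ==-≢ (x≢y ∘ sym) | *-zeroʳ ⟦ u == x ⟧ | symm G u y =
        ≤-reflexive (trans (+-identityʳ ⟦ adj G y u ⟧) (sym (+-identityʳ _)))
  ... | no u≢y | no v≢y with u Fin.≟ x | v Fin.≟ x
  ...   | yes refl | yes refl rewrite irrefl G x | ==-refl x | Bool.∧-zeroʳ (adj G y u) = z≤n
  ...   | yes refl | no v≢x rewrite ==-≢ (v≢x ∘ sym) with adj G x v | adj G y v
  ...     | false | false = z≤n
  ...     | false | true  = ≤-refl
  ...     | true  | false = ≤-refl
  ...     | true  | true  = ≤-refl
  pointwise u v | no u≢y | no v≢y | no u≢x | yes refl rewrite ==-≢ u≢x | symm G u x with adj G x u | adj G y u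
  ...     | false | false = z≤n
  ...     | false | true  = ≤-refl
  ...     | true  | false = ≤-refl
  ...     | true  | true  = ≤-refl
  pointwise u v | no u≢y | no v≢y | no u≢x | no v≢x with u Fin.≟ v
  ...   | yes refl rewrite irrefl G u = z≤n
  ...   | no _ with adj G u v
  ...     | false = z≤n
  ...     | true  = ≤-refl

  -- Only the edge xy and one edge for each common neighbour are lost, since every other neighbour
  -- of `y` is `fresh` and becomes a new neighbour of `x`.
  contract-degreeSum : degreeSum G ≤ degreeSum contract + 2 * (common G x y + 1)
  contract-degreeSum = by-adding 0
    (+-mono-≤ (subst₂ _≤_ (cross-sum G x fresh) (cross-sum contract y (adj G y)) (∑-mono λ u → ∑-mono (pointwise u)))
              (*-monoʳ-≤ 2 deg-y))
    (lemma (degreeSum G) (degreeSum contract) ∣ fresh ∣ₘ (deg G y) (common G x y))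
    where
    lemma : ∀ e e′ f d c → e′ + 2 * (c + 1) + (e + (f + f) + 2 * d) ≡ e + (e′ + (d + d) + 2 * (f + (c + 1))) + 0
    lemma = solve-∀

  module _ {s t} (a₀ : Fin s) (c₀ : Fin t) (M : HasKstMinor s t contract) where
    open KstMinorModel M renaming (connected to connected′; adjacent to adjacent′)

    π : Fin n → Fin n
    π w = if w == y then x else w

    π-y : π y ≡ x
    π-y rewrite ==-refl y = refl

    π-≢ : ∀ {w} → w ≢ y → π w ≡ w
    π-≢ w≢y rewrite ==-≢ w≢y = refl

    π≢y : ∀ w → π w ≢ y
    π≢y w with w Fin.≟ y
    ... | yes _  = x≢y
    ... | no w≢y = w≢y

    label : Fin n → Maybe (Fin s ⊎ Fin t)
    label w = branch (π w)

    label-≢ : ∀ {w b} → w ≢ y → branch w ≡ just b → label w ≡ just b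
    label-≢ w≢y p = trans (cong branch (π-≢ w≢y)) p

    label-y : ∀ {b} → branch x ≡ just b → label y ≡ just b
    label-y p = trans (cong branch π-y) p

    In : Fin s ⊎ Fin t → Fin n → Set
    In b w = label w ≡ just b

    -- An edge at `x` inherited from `y` is replaced by the two edges through `y`, which carries the
    -- label of `x`.
    lift-path : ∀ {b p q} → p ≢ y → PathIn contract (λ w → branch w ≡ just b) p q → PathIn G (In b) p q
    lift-path p≢y (here Pp) = here (label-≢ p≢y Pp)
    lift-path {b} {p} p≢y (step {w = r} Pp a path) with contract-adj a
    ... | _ , r≢y , direct p~r     = step (label-≢ p≢y Pp) p~r (lift-path r≢y path)
    ... | _ , r≢y , via-xˡ refl y~r = step (label-≢ p≢y Pp) x~y (step (label-y Pp) y~r (lift-path r≢y path))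
    ... | _ , r≢y , via-xʳ refl y~p = step (label-≢ p≢y Pp) (trans (symm G p y) y~p)
                                       (step (label-y (start path)) (trans (symm G y x) x~y) (lift-path r≢y path))
      where
      start : ∀ {P : Fin n → Set} {u v} → PathIn contract P u v → P u
      start (here p)     = p
      start (step p _ _) = p

    to-π : ∀ {b} u → In b u → PathIn G (In b) u (π u)
    to-π {b} u Pu with u Fin.≟ y
    ... | yes refl = step (label-y Pu) (trans (symm G y x) x~y) (here (label-≢ x≢y Pu))
    ... | no u≢y   = here (label-≢ u≢y Pu)

    from-π : ∀ {b} u → In b u → PathIn G (In b) (π u) u
    from-π {b} u Pu with u Fin.≟ y
    ... | yes refl = step (label-≢ x≢y Pu) x~y (here (label-y Pu))
    ... | no u≢y   = here (label-≢ u≢y Pu)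

    lift-adjacent : ∀ a c → ∃₂ λ u v → In (inj₁ a) u × In (inj₂ c) v × adj G u v ≡ true
    lift-adjacent a c with adjacent′ a c
    ... | u , v , Pu , Pv , u~v with contract-adj u~v
    ...   | u≢y , v≢y , direct u~v′      = u , v , label-≢ u≢y Pu , label-≢ v≢y Pv , u~v′
    ...   | u≢y , v≢y , via-xˡ refl y~v  = y , v , label-y Pu , label-≢ v≢y Pv , y~v
    ...   | u≢y , v≢y , via-xʳ refl y~u  = u , y , label-≢ u≢y Pu , label-y Pv , trans (symm G u y) y~u

    contract-minor : HasKstMinor s t G
    contract-minor = record
      { branch    = label
      -- `label` forgets the value of `branch` at `y`, so a witness of the old `nonempty` could be
      -- lost. Ends of edges between branch sets survive, and one index on either side supplies such
      -- an edge.
      ; nonempty  = λ { (inj₁ a) → let (u , _ , Pu , _) = lift-adjacent a c₀ in u , Pu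
                      ; (inj₂ c) → let (_ , v , _ , Pv , _) = lift-adjacent a₀ c in v , Pv }
      ; connected = λ b u v Pu Pv → path-++ (to-π u Pu)
                      (path-++ (lift-path (π≢y u) (connected′ b (π u) (π v) Pu Pv)) (from-π v Pv))
      ; adjacent  = lift-adjacent
      }

-- Reduction to a dense neighbourhood

nonIsolated≥2 : ∀ {n} (G : Graph n) {x y} → adj G x y ≡ true → 2 ≤ nonIsolated G
nonIsolated≥2 {n} G {x} {y} x~y = begin
  2                                              ≡⟨ cong₂ _+_ (∣∣-singleton x) (∣∣-singleton y) ⟨
  ∣ singleton x ∣ₘ + ∣ singleton y ∣ₘ            ≡⟨ ∑-distrib-+ (λ v → ⟦ v == x ⟧) (λ v → ⟦ v == y ⟧) ⟨
  sum (λ v → ⟦ v == x ⟧ + ⟦ v == y ⟧)            ≤⟨ ∑-mono pointwise ⟩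
  nonIsolated G                                        ∎
  where
  open ≤-Reasoning
  pointwise : ∀ v → ⟦ v == x ⟧ + ⟦ v == y ⟧ ≤ 1 ⊓ deg G v
  pointwise v with v Fin.≟ x | v Fin.≟ y
  ... | no _     | no _     = z≤n
  ... | yes refl | no _     = ≤-reflexive (sym (m≤n⇒m⊓n≡m (adjacent⇒0<deg G x~y)))
  ... | no _     | yes refl = ≤-reflexive (sym (m≤n⇒m⊓n≡m (adjacent⇒0<deg G (trans (symm G y x) x~y))))
  ... | yes refl | yes refl = ⊥-elim (adjacent⇒≢ G x~y refl)

some-edge : ∀ {n} (G : Graph n) → 0 < degreeSum G → ∃₂ λ x y → adj G x y ≡ true
some-edge G pos = let (x , 0<deg) = ∑-positive (deg G) pos in x , mask-member (adj G x) 0<deg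

-- Over the ν non-isolated vertices the average of 2 deg is at most 4K + 2/ν ≤ 4K + 1 as ν ≥ 2, and
-- 2 deg v ≤ 4K + 1 forces deg v ≤ 2K by parity.
low-degree : ∀ {n} (G : Graph n) K → 2 ≤ nonIsolated G → degreeSum G ≤ 2 * K * nonIsolated G + 1 →
             ∃ λ v → 0 < deg G v × deg G v ≤ 2 * K
low-degree {n} G K 2≤ν few =
  let (v , 0<deg , le) = choice in v , positive (deg G v) 0<deg , halve le
  where
  active : Mask n
  active v = 0 ℕ.<ᵇ deg G v
  positive : ∀ d → (0 ℕ.<ᵇ d) ≡ true → 0 < d
  positive (suc d) _ = s≤s z≤n
  active≡ : ∀ d → ⟦ 0 ℕ.<ᵇ d ⟧ ≡ 1 ⊓ d
  active≡ zero    = refl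
  active≡ (suc d) = refl
  ∣active∣ : ∣ active ∣ₘ ≡ nonIsolated G
  ∣active∣ = sum-cong-≗ {n} λ v → active≡ (deg G v)
  active-* : ∀ d → ⟦ 0 ℕ.<ᵇ d ⟧ * (2 * d) ≡ 2 * d
  active-* zero    = refl
  active-* (suc d) = *-identityˡ _
  halve : ∀ {d} → 2 * d ≤ 4 * K + 1 → d ≤ 2 * K
  halve {d} le = ≤-pred (*-cancelˡ-< 2 d (suc (2 * K)) (≤-trans (s≤s le) (≤-reflexive (lemma K))))
    where
    lemma : ∀ k → suc (4 * k + 1) ≡ 2 * suc (2 * k)
    lemma = solve-∀
  choice : ∃ λ v → active v ≡ true × 2 * deg G v ≤ 4 * K + 1
  choice = averaging active (λ v → 2 * deg G v) (λ _ → 4 * K + 1)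
    (≤-trans (s≤s z≤n) (≤-trans 2≤ν (≤-reflexive (sym ∣active∣)))) (begin
      sum (λ v → ⟦ active v ⟧ * (2 * deg G v))  ≡⟨ sum-cong-≗ {n} (λ v → active-* (deg G v)) ⟩
      sum (λ v → 2 * deg G v)                   ≡⟨ *-distribˡ-sum {n} 2 (deg G) ⟨
      2 * degreeSum G                           ≤⟨ by-adding 0 (+-mono-≤ (*-monoʳ-≤ 2 few) 2≤ν) (lemma (degreeSum G) (nonIsolated G) K) ⟩
      nonIsolated G * (4 * K + 1)                     ≡⟨ cong (_* (4 * K + 1)) ∣active∣ ⟨
      ∣ active ∣ₘ * (4 * K + 1)                 ≡⟨ *-distribʳ-sum {n} (4 * K + 1) (⟦_⟧ ∘ active) ⟩
      sum (λ v → ⟦ active v ⟧ * (4 * K + 1))    ∎)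
    where
    open ≤-Reasoning
    lemma : ∀ e m k → m * (4 * k + 1) + (2 * e + 2) ≡ 2 * e + (2 * (2 * k * m + 1) + m) + 0
    lemma = solve-∀

module _ {n s t K : ℕ} (a₀ : Fin s) (c₀ : Fin t) (0<K : 0 < K)
  (local : ∀ (G : Graph n) v → 0 < deg G v → deg G v ≤ 2 * K →
           (∀ u → adj G v u ≡ true → K ≤ common G v u) → ¬ ¬ HasKstMinor s t G)
  where

  -- m bounds the number of contractions, k the number of deletions before the next one.
  dense⇒¬¬minor′ : ∀ m k (G : Graph n) → nonIsolated G ≤ m → degreeSum G ≤ k →
    2 * K * nonIsolated G ≤ degreeSum G → 0 < degreeSum G → ¬ ¬ HasKstMinor s t G
  dense⇒¬¬minor′ m k G ν≤m e≤k dense 0<e with any? (λ x → any? (λ y → (adj G x y Bool.≟ true) ×-dec (common G x y ℕ.<? K)))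
  dense⇒¬¬minor′ zero k G ν≤m e≤k dense 0<e | yes (x , y , x~y , few) =
    ⊥-elim (<⇒≱ (≤-trans (s≤s z≤n) (nonIsolated≥2 G x~y)) ν≤m)
  dense⇒¬¬minor′ (suc m) k G ν≤m e≤k dense 0<e | yes (x , y , x~y , few) =
    λ ¬minor → dense⇒¬¬minor′ m (degreeSum contract) contract
      (≤-pred (≤-trans contract-nonIsolated ν≤m)) ≤-refl dense′ 0<e′ (¬minor ∘ contract-minor a₀ c₀)
    where
    open Contract G x y x~y
    e ν e′ ν′ c : ℕ
    e = degreeSum G
    ν = nonIsolated G
    e′ = degreeSum contract
    ν′ = nonIsolated contract
    c = common G x y
    -- The degree sum drops by at most 2(c + 1) ≤ 2K, while ν drops by at least 1.
    dense′ : 2 * K * ν′ ≤ e′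
    dense′ = by-adding 0
      (+-mono-≤ (+-mono-≤ (*-monoʳ-≤ (2 * K) contract-nonIsolated) dense) (+-mono-≤ contract-degreeSum (*-monoʳ-≤ 2 few)))
      (lemma e ν e′ ν′ c K)
      where
      lemma : ∀ e ν e′ ν′ c k → e′ + (2 * k * (1 + ν′) + 2 * k * ν + (e + 2 * (1 + c))) ≡
                                2 * k * ν′ + (2 * k * ν + e + (e′ + 2 * (c + 1) + 2 * k)) + 0
      lemma = solve-∀
    0<e′ : 0 < e′
    0<e′ = ≤-trans 0<K (by-adding K
      (+-mono-≤ (+-mono-≤ (*-monoʳ-≤ (2 * K) (nonIsolated≥2 G x~y)) dense) (+-mono-≤ contract-degreeSum (*-monoʳ-≤ 2 few)))
      (lemma e ν e′ c K))
      where
      lemma : ∀ e ν e′ c k → e′ + (2 * k * 2 + 2 * k * ν + (e + 2 * (1 + c))) ≡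
                                k + (2 * k * ν + e + (e′ + 2 * (c + 1) + 2 * k)) + k
      lemma = solve-∀
  -- Deleting an edge costs 2 in the degree sum, so it is safe once e ≥ 2Kν + 2; the excess of 1
  -- left over otherwise is tolerated by `low-degree`.
  ... | no rich with degreeSum G ℕ.≤? 2 * K * nonIsolated G + 1
  ...   | yes few = let (v , 0<deg , deg≤2K) = low-degree G K (nonIsolated≥2 G x~y) few in
          local G v 0<deg deg≤2K λ u v~u → ≮⇒≥ λ lt → rich (v , u , v~u , lt)
    where x~y = proj₂ (proj₂ (some-edge G 0<e))
  dense⇒¬¬minor′ m zero    G ν≤m e≤k dense 0<e | no rich | no many = ⊥-elim (<⇒≱ 0<e e≤k)
  dense⇒¬¬minor′ m (suc k) G ν≤m e≤k dense 0<e | no rich | no many =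
    λ ¬minor → dense⇒¬¬minor′ m k delete (≤-trans delete-nonIsolated ν≤m) (≤-pred (≤-trans delete-< e≤k))
      (≤-trans (*-monoʳ-≤ (2 * K) delete-nonIsolated) dense′) (≤-trans 0<2Kν dense′) (¬minor ∘ delete-minor)
    where
    x~y = proj₂ (proj₂ (some-edge G 0<e))
    open Delete G _ _ x~y
    dense′ : 2 * K * nonIsolated G ≤ degreeSum delete
    dense′ = +-cancelʳ-≤ 2 _ _ (≤-trans (≤-reflexive (+-suc (2 * K * nonIsolated G) 1)) (≤-trans (≰⇒> many) delete-degreeSum))
    0<2Kν : 0 < 2 * K * nonIsolated G
    0<2Kν = *-mono-≤ {1} {2 * K} {1} {nonIsolated G} (≤-trans 0<K (m≤m+n K _)) (≤-trans (s≤s z≤n) (nonIsolated≥2 G x~y))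

  dense⇒¬¬minor : (G : Graph n) → 2 * K * nonIsolated G ≤ degreeSum G → 0 < degreeSum G → ¬ ¬ HasKstMinor s t G
  dense⇒¬¬minor G = dense⇒¬¬minor′ (nonIsolated G) (degreeSum G) G ≤-refl ≤-refl

-- The degree sum inside the neighbourhood is at least hK, and h ≤ 2K gives 3h² ≤ 6hK.
neighbourhood-dense : ∀ {n} (G : Graph n) K v → deg G v ≤ 2 * K →
  (∀ u → adj G v u ≡ true → K ≤ common G v u) → Dense G K (adj G v)
neighbourhood-dense {n} G K v deg≤2K rich = begin
  3 * (h * h) + 2 * K * h     ≤⟨ by-adding 0 (*-monoʳ-≤ (3 * h) deg≤2K) (lemma h K) ⟩
  8 * (h * K)                 ≤⟨ *-monoʳ-≤ 8 h*K≤ ⟩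
  8 * edges G (adj G v)       ∎
  where
  open ≤-Reasoning
  h = deg G v
  lemma : ∀ h k → 8 * (h * k) + 3 * h * h ≡ 3 * (h * h) + 2 * k * h + 3 * h * (2 * k) + 0
  lemma = solve-∀
  row : ∀ u → ⟦ adj G v u ⟧ * K ≤ ⟦ adj G v u ⟧ * cover G (adj G v) u
  row u with adj G v u in v~u
  ... | false = z≤n
  ... | true  = *-monoʳ-≤ 1 (≤-trans (rich u v~u) (∑-mono λ w → pointwise (adj G v w) (adj G u w)))
    where
    pointwise : ∀ a b → ⟦ a ∧ b ⟧ ≤ ⟦ b ⟧ * ⟦ a ⟧
    pointwise false b     = z≤n
    pointwise true  false = z≤n
    pointwise true  true  = ≤-refl
  h*K≤ : h * K ≤ edges G (adj G v)
  h*K≤ = ≤-trans (≤-reflexive (*-distribʳ-sum {n} K (⟦_⟧ ∘ adj G v))) (∑-mono row)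

-- The numerical choice of the sizes

sum-tabulate : ∀ {n} (f : Fin n → ℕ) → List.sum (tabulate f) ≡ sum f
sum-tabulate {zero}  f = refl
sum-tabulate {suc n} f = cong (f zero ℕ.+_) (sum-tabulate (f ∘ suc))

sum-allFin : ∀ {n} (f : Fin n → ℕ) → List.sum (map f (allFin n)) ≡ sum f
sum-allFin f = trans (cong List.sum (map-tabulate id f)) (sum-tabulate f)

2*edgeCount≤degreeSum : ∀ {n} (G : Graph n) → 2 * edgeCount G ≤ degreeSum G
2*edgeCount≤degreeSum {n} G = begin
  2 * edgeCount G                                          ≡⟨ cong (edgeCount G ℕ.+_) (+-identityʳ (edgeCount G)) ⟩
  edgeCount G ℕ.+ edgeCount G                              ≡⟨ cong₂ ℕ._+_ edgeCount≡ (trans edgeCount≡ flipped) ⟩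
  sum (λ i → sum (up i)) ℕ.+ sum (λ i → sum (down i))      ≡⟨ ∑∑-distrib-+ up down ⟨
  sum (λ i → sum λ j → up i j ℕ.+ down i j)                ≤⟨ ∑-mono (λ i → ∑-mono λ j → pointwise i j (adj G i j)) ⟩
  degreeSum G                                              ∎
  where
  open ≤-Reasoning
  up down : Fin n → Fin n → ℕ
  up i j = ⟦ (toℕ i <ᵇ toℕ j) ∧ adj G i j ⟧
  down i j = ⟦ (toℕ j <ᵇ toℕ i) ∧ adj G i j ⟧
  edgeCount≡ : edgeCount G ≡ sum (λ i → sum (up i))
  edgeCount≡ = trans (sum-allFin (λ i → List.sum (map (up i) (allFin n)))) (sum-cong-≗ {n} λ i → sum-allFin (up i))
  flipped : sum (λ i → sum (up i)) ≡ sum (λ i → sum (down i))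
  flipped = trans (∑-comm {n} {n} up)
    (sum-cong-≗ {n} λ i → sum-cong-≗ {n} λ j → cong (λ a → ⟦ (toℕ j <ᵇ toℕ i) ∧ a ⟧) (symm G j i))
  exclusive : ∀ a b → (a <ᵇ b) ≡ true → (b <ᵇ a) ≡ true → ⊥
  exclusive a b p q = <-asym (<ᵇ⇒< a b (subst T (sym p) tt)) (<ᵇ⇒< b a (subst T (sym q) tt))
  pointwise : ∀ i j a → ⟦ (toℕ i <ᵇ toℕ j) ∧ a ⟧ ℕ.+ ⟦ (toℕ j <ᵇ toℕ i) ∧ a ⟧ ≤ ⟦ a ⟧
  pointwise i j a with toℕ i <ᵇ toℕ j in p | toℕ j <ᵇ toℕ i in q
  ... | false | false = z≤n
  ... | false | true  = ≤-refl
  ... | true  | false = ≤-reflexive (+-identityʳ ⟦ a ⟧)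
  ... | true  | true  = ⊥-elim (exclusive (toℕ i) (toℕ j) p q)

nonIsolated≤ : ∀ {n} (G : Graph n) → nonIsolated G ≤ n
nonIsolated≤ {n} G = ≤-trans (∑-mono {n} {g = λ _ → 1} λ v → m⊓n≤m 1 (deg G v)) (≤-reflexive (∑-const-1 n))

-- p + 3 and q + 1 are the sizes of the branch sets on the two sides; d stands for K + 1 - 40 (s + t).
module _ (s t K d p q : ℕ) (0<s : 0 < s) (s≤t : s ≤ t) (K+1≡ : K + 1 ≡ 40 * (s + t) + d) (0<d : 0 < d)
  (20sp≤ : 20 * s * p ≤ d + 20 * s) (16tq≤ : 16 * t * suc q ≤ d + 16 * t)
  (small : 4 ^ (p * suc q) * s < 5 ^ (p * suc q))
  where

  private
    x y : ℕ
    x = s * suc (2 + p)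
    y = x + t * suc q

    0<x : 0 < x
    0<x = ≤-trans 0<s (m≤m*n s (3 + p))

    60≤K : 60 ≤ K
    60≤K = +-cancelʳ-≤ 1 60 K (begin
      61                  ≤⟨ m≤n+m 61 20 ⟩
      40 * (1 + 1) + 1    ≤⟨ +-mono-≤ (*-monoʳ-≤ 40 (+-mono-≤ 0<s (≤-trans 0<s s≤t))) 0<d ⟩
      40 * (s + t) + d    ≡⟨ K+1≡ ⟨
      K + 1               ∎)
      where open ≤-Reasoning

    -- 20 s (p + 3) ≤ d + 80 s ≤ d + 40 (s + t), by s ≤ t.
    20x≤ : 20 * x ≤ K + 1
    20x≤ = ≤-trans (by-adding 0 (+-mono-≤ 20sp≤ (*-monoʳ-≤ 40 s≤t)) (lemma s t p d)) (≤-reflexive (sym K+1≡))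
      where
      lemma : ∀ s t p d → 40 * (s + t) + d + (20 * s * p + 40 * s) ≡ 20 * (s * (3 + p)) + (d + 20 * s + 40 * t) + 0
      lemma = solve-∀

    -- Of the 9 (K + 1), four parts bound 80x and five bound 80 t (q + 1) ≤ 5d + 80t.
    80y≤ : 80 * y ≤ 9 * (K + 1)
    80y≤ = by-adding (200 * s + 120 * t)
      (+-mono-≤ (*-monoʳ-≤ 4 20x≤) (+-mono-≤ (*-monoʳ-≤ 5 16tq≤) (≤-reflexive (cong (5 *_) (sym K+1≡)))))
      (lemma s t (K + 1) d (suc q) x)
      where
      lemma : ∀ s t k d q x →
        9 * k + (4 * (20 * x) + (5 * (16 * t * q) + 5 * (40 * (s + t) + d))) ≡
        80 * (x + t * q) + (4 * k + (5 * (d + 16 * t) + 5 * k)) + (200 * s + 120 * t)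
      lemma = solve-∀

  density⇒¬¬minor : ∀ {n} (G : Graph n) → 0 < n → K * n ≤ edgeCount G → ¬ ¬ HasKstMinor s t G
  density⇒¬¬minor {n} G 0<n Kn≤e =
    dense⇒¬¬minor (Fin.fromℕ< 0<s) (Fin.fromℕ< (≤-trans 0<s s≤t)) 0<K local G
      (≤-trans (*-monoʳ-≤ (2 * K) (nonIsolated≤ G)) 2Kn≤) (≤-trans (*-mono-≤ (*-mono-≤ {1} {2} (s≤s z≤n) 0<K) 0<n) 2Kn≤)
    where
    0<K : 0 < K
    0<K = ≤-trans (s≤s z≤n) 60≤K
    2Kn≤ : 2 * K * n ≤ degreeSum G
    2Kn≤ = ≤-trans (≤-reflexive (*-assoc 2 K n)) (≤-trans (*-monoʳ-≤ 2 Kn≤e) (2*edgeCount≤degreeSum G))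
    local : ∀ (H : Graph n) v → 0 < deg H v → deg H v ≤ 2 * K →
            (∀ u → adj H v u ≡ true → K ≤ common H v u) → ¬ ¬ HasKstMinor s t H
    local H v 0<deg deg≤2K rich ¬minor =
      no-dense-mask H K s t p q 60≤K 0<x ≤-refl ≤-refl 20x≤ 80y≤
        (subst₂ (λ a b → a * s < b) (sym (^-*-assoc 4 p (suc q))) (sym (^-*-assoc 5 p (suc q))) small)
        ¬minor (deg H v) (adj H v) ≤-refl 0<deg deg≤2K (neighbourhood-dense H K v deg≤2K rich)

-- Rounding, and passing from the rational density to integer sizes

m<suc[m/n]*n : ∀ m n .⦃ _ : ℕ.NonZero n ⦄ → m < suc (m ℕ./ n) * n
m<suc[m/n]*n m n = begin-strict
  m                          ≡⟨ m≡m%n+[m/n]*n m n ⟩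
  m ℕ.% n + m ℕ./ n * n        <⟨ +-monoˡ-< (m ℕ./ n * n) (m%n<n m n) ⟩
  suc (m ℕ./ n) * n          ∎
  where open ≤-Reasoning

*-suc-/-≤ : ∀ d n .⦃ _ : ℕ.NonZero n ⦄ → n * suc (d ℕ./ n) ≤ d + n
*-suc-/-≤ d n = begin
  n * suc (d ℕ./ n)     ≡⟨ *-suc n (d ℕ./ n) ⟩
  n + n * (d ℕ./ n)     ≡⟨ cong (n ℕ.+_) (*-comm n (d ℕ./ n)) ⟩
  n + d ℕ./ n * n       ≤⟨ +-monoʳ-≤ n (m/n*n≤m d n) ⟩
  n + d                 ≡⟨ +-comm n d ⟩
  d + n                 ∎
  where open ≤-Reasoning

d≤*-suc-/ : ∀ d n .⦃ _ : ℕ.NonZero n ⦄ → d ≤ n * suc (d ℕ./ n)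
d≤*-suc-/ d n = ≤-trans (<⇒≤ (m<suc[m/n]*n d n)) (≤-reflexive (*-comm (suc (d ℕ./ n)) n))

-- For c = 40 (s + t) this is d(G)/40 - (s + t), the number to be compared with the square root.
excess : ∀ {n} → ℕ → Graph (suc n) → ℚ
excess c G = (density G - ι c) ℚ.* ((+ 1) / 40)

0<excess⇒ : ∀ {n} c (G : Graph (suc n)) → ¬ excess c G ℚ.≤ 0ℚ → c * suc n ≤ edgeCount G
0<excess⇒ {n} c G pos = ≮⇒≥ λ e<cn → pos (begin
  (density G - ι c) ℚ.* ((+ 1) / 40)   ≤⟨ *-monoʳ (0≤/ 1 39) (ℚ.+-monoˡ-≤ (ℚ.- ι c)
                                            (/-mono-≤ {edgeCount G} {n} {c} {0} (≤-trans (≤-reflexive (*-identityʳ (edgeCount G))) (<⇒≤ e<cn)))) ⟩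
  (ι c - ι c) ℚ.* ((+ 1) / 40)         ≡⟨ cong (ℚ._* ((+ 1) / 40)) (ℚ.+-inverseʳ (ι c)) ⟩
  0ℚ ℚ.* ((+ 1) / 40)                  ≡⟨ ℚ.*-zeroˡ ((+ 1) / 40) ⟩
  0ℚ                                   ∎)
  where open ℚ.≤-Reasoning

excess≤ : ∀ {n} c d (G : Graph (suc n)) → edgeCount G ≤ (c + d) * suc n → excess c G ℚ.≤ ι d ℚ.* ((+ 1) / 40)
excess≤ {n} c d G e≤ = *-monoʳ (0≤/ 1 39) (begin
  density G - ι c           ≤⟨ ℚ.+-monoˡ-≤ (ℚ.- ι c) (/-mono-≤ {edgeCount G} {n} {c + d} {0} (≤-trans (≤-reflexive (*-identityʳ (edgeCount G))) e≤)) ⟩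
  ι (c + d) - ι c           ≡⟨ cong (_- ι c) (ι-+ c d) ⟩
  ι c ℚ.+ ι d - ι c         ≡⟨ cancel (ι c) (ι d) ⟩
  ι d                       ∎)
  where
  open ℚ.≤-Reasoning
  open +-*-Solver
  cancel : ∀ a b → a ℚ.+ b - a ≡ b
  cancel = solve 2 (λ a b → a :+ b :- a := b) refl

-- (d/40)² ≤ 320 (m + 1) r / 1600, and 320/1600 = 1/5 is the rate in `exceeds⇒power`, where `r`
-- becomes the exponent.
excess²≤ : ∀ {d m r X} → 0ℚ ℚ.≤ X → X ℚ.≤ ι d ℚ.* ((+ 1) / 40) → d * d ≤ 320 * (suc m * r) →
  X ℚ.* X ℚ.* ((+ 1) / suc m) ℚ.≤ ι r ℚ.* ((+ 1) / 5)
excess²≤ {d} {m} {r} {X} 0≤X X≤ dd≤ = begin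
  X ℚ.* X ℚ.* c                                         ≤⟨ *-monoʳ (0≤/ 1 m) (*-mono 0≤X (ℚ.≤-trans 0≤X X≤) X≤ X≤) ⟩
  (ι d ℚ.* f) ℚ.* (ι d ℚ.* f) ℚ.* c                     ≡⟨ regroup (ι d) f c ⟩
  (ι d ℚ.* ι d) ℚ.* (f ℚ.* f ℚ.* c)                     ≡⟨ cong (ℚ._* (f ℚ.* f ℚ.* c)) (ι-* d d) ⟨
  ι (d * d) ℚ.* (f ℚ.* f ℚ.* c)                         ≤⟨ *-monoʳ (*-nonneg (*-nonneg (0≤/ 1 39) (0≤/ 1 39)) (0≤/ 1 m)) (ι-mono-≤ dd≤) ⟩
  ι (320 * (suc m * r)) ℚ.* (f ℚ.* f ℚ.* c)             ≡⟨ cong (ℚ._* (f ℚ.* f ℚ.* c)) (trans (ι-* 320 (suc m * r)) (cong (ι 320 ℚ.*_) (ι-* (suc m) r))) ⟩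
  ι 320 ℚ.* (ι (suc m) ℚ.* ι r) ℚ.* (f ℚ.* f ℚ.* c)     ≡⟨ regroup′ (ι 320) (ι (suc m)) (ι r) f c ⟩
  (ι (suc m) ℚ.* c) ℚ.* (ι r ℚ.* (ι 320 ℚ.* (f ℚ.* f))) ≡⟨ cong₂ (λ a b → a ℚ.* (ι r ℚ.* b)) (ι-inverse m) refl ⟩
  1ℚ ℚ.* (ι r ℚ.* ((+ 1) / 5))                          ≡⟨ ℚ.*-identityˡ (ι r ℚ.* ((+ 1) / 5)) ⟩
  ι r ℚ.* ((+ 1) / 5)                                   ∎
  where
  open ℚ.≤-Reasoning
  open +-*-Solver
  c f : ℚ
  c = (+ 1) / suc m
  f = (+ 1) / 40
  regroup : ∀ D f c → (D ℚ.* f) ℚ.* (D ℚ.* f) ℚ.* c ≡ (D ℚ.* D) ℚ.* (f ℚ.* f ℚ.* c)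
  regroup = solve 3 (λ D f c → (D :* f) :* (D :* f) :* c := (D :* D) :* (f :* f :* c)) refl
  regroup′ : ∀ a b r f c → a ℚ.* (b ℚ.* r) ℚ.* (f ℚ.* f ℚ.* c) ≡ (b ℚ.* c) ℚ.* (r ℚ.* (a ℚ.* (f ℚ.* f)))
  regroup′ = solve 5 (λ a b r f c → a :* (b :* r) :* (f :* f :* c) := (b :* c) :* (r :* (a :* (f :* f)))) refl

large-excess⇒¬¬minor : ∀ s t {n} (G : Graph (suc n)) → suc s ≤ suc t → ¬ excess (40 * (suc s + suc t)) G ℚ.≤ 0ℚ →
  ∀ N → ¬ expPartial (excess (40 * (suc s + suc t)) G ℚ.* excess (40 * (suc s + suc t)) G ℚ.* ((+ 1) / (suc s * suc t))) N ℚ.≤ ι (suc s) →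
  ¬ ¬ HasKstMinor (suc s) (suc t) G
large-excess⇒¬¬minor s t {n} G s≤t pos N exceeds =
  density⇒¬¬minor (suc s) (suc t) K d p q (s≤s z≤n) s≤t K+1≡ (s≤s z≤n)
    (*-suc-/-≤ d (20 * suc s)) (*-suc-/-≤ d (16 * suc t))
    (Exponential.exceeds⇒power {m = p * suc q} {N} (*-nonneg (*-nonneg 0≤X 0≤X) (0≤/ 1 (t + s * suc t)))
      (excess²≤ {d} {t + s * suc t} {p * suc q} 0≤X (excess≤ c d G e≤) dd≤) (ℚ.≰⇒> exceeds))
    G (s≤s z≤n) (m/n*n≤m (edgeCount G) (suc n))
  where
  c K d p q : ℕ
  c = 40 * (suc s + suc t)
  K = edgeCount G ℕ./ suc n
  -- The added 1 makes c + d = K + 1 an upper bound for the density.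
  d = suc (K ∸ c)
  -- For d ≈ 40x these are p ≈ 2x/s and q + 1 ≈ 5x/(2t). Both `p` and `suc q` exceed the exact
  -- quotients, so d² ≤ 20 s p · 16 t (q + 1), whence the 320.
  p = suc (d ℕ./ (20 * suc s))
  q = d ℕ./ (16 * suc t)
  X : ℚ
  X = excess c G
  0≤X : 0ℚ ℚ.≤ X
  0≤X = ℚ.<⇒≤ (ℚ.≰⇒> pos)
  c≤K : c ≤ K
  c≤K = ≤-trans (≤-reflexive (sym (m*n/n≡m c (suc n)))) (/-monoˡ-≤ (suc n) (0<excess⇒ c G pos))
  c+d≡ : c + d ≡ suc K
  c+d≡ = trans (+-suc c (K ∸ c)) (cong suc (m+[n∸m]≡n c≤K))
  K+1≡ : K + 1 ≡ c + d
  K+1≡ = trans (+-comm K 1) (sym c+d≡)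
  e≤ : edgeCount G ≤ (c + d) * suc n
  e≤ = ≤-trans (<⇒≤ (m<suc[m/n]*n (edgeCount G) (suc n))) (≤-reflexive (cong (_* suc n) (sym c+d≡)))
  dd≤ : d * d ≤ 320 * (suc s * suc t * (p * suc q))
  dd≤ = ≤-trans (*-mono-≤ (d≤*-suc-/ d (20 * suc s)) (d≤*-suc-/ d (16 * suc t))) (≤-reflexive (lemma (suc s) (suc t) p (suc q)))
    where
    lemma : ∀ s t p q → 20 * s * p * (16 * t * q) ≡ 320 * (s * t * (p * q))
    lemma = solve-∀

-- The minor is only obtained up to double negation. This suffices since comparisons of rationals
-- are decidable: the first selects the disjunct, and the bound on each partial sum is stable.
≤√-stable : ∀ X m s → (¬ X ℚ.≤ 0ℚ → ∀ N → ¬ ¬ expPartial (X ℚ.* X ℚ.* ((+ 1) / suc m)) N ℚ.≤ ι s) →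
            LeSqrtMulLog X (suc m) s
≤√-stable X m s bound with X ℚ.≤? 0ℚ
... | yes X≤0 = inj₁ X≤0
... | no  X≰0 = inj₂ λ N → decidable-stable (expPartial (X ℚ.* X ℚ.* ((+ 1) / suc m)) N ℚ.≤? ι s) (bound X≰0 N)

theorem1p10 : (s t : ℕ) → 2 ≤ s → s ≤ t →
    (n : ℕ) (G : Graph (suc n)) → ¬ HasKstMinor s t G →
    LeSqrtMulLog ((density G - (+ (40 * (s + t))) / 1) ℚ.* ((+ 1) / 40)) (s * t) s
theorem1p10 (suc s) (suc t) 2≤s s≤t n G ¬minor =
  -- The product `suc s * suc t` computes to `suc (t + s * suc t)`, which selects the exponential
  -- case of `LeMulLog`.
  ≤√-stable (excess (40 * (suc s + suc t)) G) (t + s * suc t) (suc s)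
    λ X≰0 N exceeds → large-excess⇒¬¬minor s t G s≤t X≰0 N exceeds ¬minor
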